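{- Let $s=(s(1),\dots,s(n))$ be a weak composition. Define the edge labeling $\lambda$ of the Hasse diagram of $s$-weak order by $\lambda(T,Z)=a$ for every cover relation $T\lessdot Z$, where $(a,b)$ is the unique tree ascent of $T$ such that $Z$ is the $s$-tree rotation of $T$ along $(a,b)$. Then $\lambda$ is an SB-labeling of $s$-weak order.
   Context: A weak composition is a sequence $s=(s(1),\dots,s(n))$ of nonnegative integers. An $s$-decreasing tree is a planar rooted tree $T$ whose internal vertices are labeled bijectively by $1,\dots,n$ (leaves are unlabeled), such that internal vertex $i$ has exactly $s(i)+1$ children, indexed $0,1,\dots,s(i)$ from left to right, and every labeled descendant of $i$ has a label smaller than $i$. Write $T^i$ for the full subtree rooted at $i$ and $T^i_j$ for the full subtree rooted at the $j$-th child of $i$; "$x\in T^i_j$" means $x$ is a labeled vertex of that subtree. For $1\le x<y\le n$ the cardinality $\#_T(y,x)$ is: $0$ if $x$ is to the left of $y$ in $T$ or $x\in T^y_0$; $i$ if $x\in T^y_i$ with $0<i<s(y)$; $s(y)$ if $x\in T^y_{s(y)}$ or $x$ is to the right of $y$ in $T$. A multi-inversion set on $[n]$ is a multiset $I$ of pairs $(y,x)$ with $1\le x<y\le n$, with multiplicities $\#_I(y,x)$ ($0$ if absent); $\mathrm{inv}(T)$ is the multi-inversion set with $\#_{\mathrm{inv}(T)}(y,x)=\#_T(y,x)$. For multi-inversion sets, $I\subseteq J$ means $\#_I(y,x)\le \#_J(y,x)$ for all pairs; $I\cup J$ has multiplicities $\max(\#_I,\#_J)$; $I+J$ has multiplicities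 $\min(\#_I(y,x)+\#_J(y,x),s(y))$, and $I+(b,a)$ means $I+\{(b,a)\}$. $I$ is transitive if for all $a<b<c$ with $\#_I(c,b)=i$, either $\#_I(b,a)=0$ or $\#_I(c,a)\ge i$; $I^{tc}$ is the smallest transitive multi-inversion set containing $I$. The $s$-weak order is the partial order on $s$-decreasing trees with $T\preceq Z$ iff $\mathrm{inv}(T)\subseteq \mathrm{inv}(Z)$; it is a finite lattice with $\mathrm{inv}(T\vee Z)=(\mathrm{inv}(T)\cup\mathrm{inv}(Z))^{tc}$. For $1\le a<b\le n$, $(a,b)$ is a tree ascent of $T$ if (i) $a\in T^b_i$ for some $0\le i<s(b)$; (ii) whenever $a<e<b$ and $a\in T^e_j$, then $j=s(e)$; (iii) if $s(a)>0$ then $T^a_{s(a)}$ is a leaf. For a tree ascent $(a,b)$ of $T$, $(\mathrm{inv}(T)+(b,a))^{tc}$ equals $\mathrm{inv}(Z)$ for a unique $s$-decreasing tree $Z$, called the $s$-tree rotation of $T$ along $(a,b)$. It is known that $T\lessdot Z$ (cover) iff $Z$ is the $s$-tree rotation of $T$ along a unique tree ascent of $T$. An SB-labeling of a finite lattice $L$ is an edge labeling $\lambda$ of its Hasse diagram such that for all $u,v,w\in L$ with $v\ne w$ both covering $u$: (i) $\lambda(u,v)\neq\lambda(u,w)$; (ii) every saturated chain from $u$ to $v\vee w$ uses both labels $\lambda(u,v)$ and $\lambda(u,w)$ a positive number of times; (iii) no saturated chain from $u$ to $v\vee w$ uses any label other than $\lambda(u,v)$ and $\lambda(u,w)$. 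-}

module Defs where

open import Data.Nat using (ℕ; zero; suc; _+_; _≤_; _<_; _⊔_; _⊓_; _≡ᵇ_; _<ᵇ_)
open import Data.Bool using (Bool; true; false; if_then_else_; _∧_)
open import Data.List using (List; []; _∷_; _++_; length; map; upTo)
open import Data.List.Membership.Propositional using (_∈_)
open import Data.List.Relation.Unary.All using (All)
open import Data.List.Relation.Binary.Permutation.Propositional using (_↭_)
open import Data.Maybe using (Maybe; just; nothing)
open import Data.Product using (Σ; _×_)
open import Data.Sum using (_⊎_)
open import Data.Empty using (⊥)
open import Data.Unit using (⊤)
open import Relation.Binary.PropositionalEquality using (_≡_; _≢_)

-- Weak compositions: s = (s(1),…,s(n)) is a list of naturals, n = length s.
-- Labels are the naturals 1,…,n.

at : List ℕ → ℕ → ℕ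
at []       _       = 0
at (x ∷ _)  zero    = x
at (_ ∷ xs) (suc k) = at xs k

-- s(i) for 1 ≤ i ≤ n (value outside this range is irrelevant)
sv : List ℕ → ℕ → ℕ
sv s zero    = 0
sv s (suc k) = at s k

-- Planar rooted trees: leaves unlabeled, internal vertices labeled,
-- children ordered left to right (indexed 0,1,2,…).

data Tree : Set where
  leaf : Tree
  node : ℕ → List Tree → Tree

labels  : Tree → List ℕ
labelsL : List Tree → List ℕ
labels leaf        = []
labels (node i ts) = i ∷ labelsL ts
labelsL []       = []
labelsL (t ∷ ts) = labels t ++ labelsL ts

data DecShape (s : List ℕ) : Tree → Set where
  leaf : DecShape s leaf
  node : ∀ i ts →
         length ts ≡ suc (sv s i) →
         All (λ t → All (λ x → x < i) (labels t)) ts →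
         All (DecShape s) ts →
         DecShape s (node i ts)

IsSTree : List ℕ → Tree → Set
IsSTree s T = DecShape s T × (labels T ↭ map suc (upTo (length s)))

pathTo  : ℕ → Tree → Maybe (List ℕ)
pathToL : ℕ → ℕ → List Tree → Maybe (List ℕ)
pathTo v leaf        = nothing
pathTo v (node i ts) = if v ≡ᵇ i then just [] else pathToL v 0 ts
pathToL v k []       = nothing
pathToL v k (t ∷ ts) with pathTo v t
... | just p  = just (k ∷ p)
... | nothing = pathToL v (suc k) ts

subT  : ℕ → Tree → Maybe Tree
subTL : ℕ → List Tree → Maybe Tree
subT v leaf        = nothing
subT v (node i ts) = if v ≡ᵇ i then just (node i ts) else subTL v ts
subTL v []       = nothing
subTL v (t ∷ ts) with subT v t
... | just r  = just r
... | nothing = subTL v ts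

childAt : ℕ → List Tree → Maybe Tree
childAt _       []       = nothing
childAt zero    (t ∷ _)  = just t
childAt (suc j) (_ ∷ ts) = childAt j ts

childOf : ℕ → Maybe Tree → Maybe Tree
childOf j (just (node _ ts)) = childAt j ts
childOf j _                  = nothing

childSub : ℕ → ℕ → Tree → Maybe Tree
childSub v j T = childOf j (subT v T)

InChild : Tree → ℕ → ℕ → ℕ → Set
InChild T v j x = Σ Tree (λ t → childSub v j T ≡ just t × x ∈ labels t)

-- Cardinality #_T(y,x) (for x < y).
-- Compare the root paths of y and x:
--  * path(y) a prefix of path(x), x at child j of y  ⇒ x ∈ T^y_j, value j
--    (j = 0 gives 0, 0<j<s(y) gives j, j = s(y) gives s(y));
--  * first difference with x's branch to the left  ⇒ x left of y, value 0;
--  * first difference with x's branch to the right ⇒ x right of y, value s(y).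
cmpPaths : ℕ → List ℕ → List ℕ → ℕ
cmpPaths sy []       []       = 0
cmpPaths sy []       (j ∷ _)  = j
cmpPaths sy (_ ∷ _)  []       = 0
cmpPaths sy (p ∷ ps) (q ∷ qs) =
  if p ≡ᵇ q then cmpPaths sy ps qs else (if q <ᵇ p then 0 else sy)

cardM : ℕ → Maybe (List ℕ) → Maybe (List ℕ) → ℕ
cardM sy (just py) (just px) = cmpPaths sy py px
cardM sy _         _         = 0

card : List ℕ → Tree → ℕ → ℕ → ℕ
card s T y x = cardM (sv s y) (pathTo y T) (pathTo x T)

-- Multi-inversion sets: multiplicity functions  #_I(y,x) = I y x ,
-- only pairs 1 ≤ x < y ≤ n are relevant.

MIS : Set
MIS = ℕ → ℕ → ℕ

inv : List ℕ → Tree → MIS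
inv s T y x = card s T y x

_⊆[_]_ : MIS → ℕ → MIS → Set
I ⊆[ n ] J = ∀ x y → 1 ≤ x → x < y → y ≤ n → I y x ≤ J y x

plusM : List ℕ → MIS → MIS → MIS
plusM s I J y x = (I y x + J y x) ⊓ sv s y

single : ℕ → ℕ → MIS
single b a y x = if (y ≡ᵇ b) ∧ (x ≡ᵇ a) then 1 else 0

Transitive : ℕ → MIS → Set
Transitive n I = ∀ a b c → 1 ≤ a → a < b → b < c → c ≤ n →
                 (I b a ≡ 0) ⊎ (I c b ≤ I c a)

IsTC : ℕ → MIS → MIS → Set
IsTC n I K = Transitive n K × I ⊆[ n ] K ×
             (∀ J → Transitive n J → I ⊆[ n ] J → K ⊆[ n ] J)

_≼[_]_ : Tree → List ℕ → Tree → Set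
T ≼[ s ] Z = inv s T ⊆[ length s ] inv s Z

_≺[_]_ : Tree → List ℕ → Tree → Set
T ≺[ s ] Z = T ≼[ s ] Z × (Z ≼[ s ] T → ⊥)

Cover : List ℕ → Tree → Tree → Set
Cover s T Z = IsSTree s T × IsSTree s Z × T ≺[ s ] Z ×
              (∀ W → IsSTree s W → T ≺[ s ] W → W ≺[ s ] Z → ⊥)

IsJoin : List ℕ → Tree → Tree → Tree → Set
IsJoin s v w J = IsSTree s J × v ≼[ s ] J × w ≼[ s ] J ×
                 (∀ U → IsSTree s U → v ≼[ s ] U → w ≼[ s ] U → J ≼[ s ] U)

TreeAscent : List ℕ → Tree → ℕ → ℕ → Set
TreeAscent s T a b =
  1 ≤ a × a < b × b ≤ length s ×
  Σ ℕ (λ i → i < sv s b × InChild T b i a) ×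
  (∀ e j → a < e → e < b → InChild T e j a → j ≡ sv s e) ×
  (0 < sv s a → childSub a (sv s a) T ≡ just leaf)

IsRotation : List ℕ → Tree → ℕ → ℕ → Tree → Set
IsRotation s T a b Z =
  IsSTree s Z × IsTC (length s) (plusM s (inv s T) (single b a)) (inv s Z)

RotLabel : List ℕ → Tree → Tree → ℕ → Set
RotLabel s T Z a = Σ ℕ (λ b → TreeAscent s T a b × IsRotation s T a b Z)

Labeling : List ℕ → Set
Labeling s = ∀ T Z → Cover s T Z → ℕ

data SatChain (s : List ℕ) : Tree → Tree → Set where
  done : ∀ {t} → SatChain s t t
  step : ∀ {t t′ t″} → Cover s t t′ → SatChain s t′ t″ → SatChain s t t″

Uses : ∀ {s u J} → Labeling s → SatChain s u J → ℕ → Set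
Uses lab done                       a = ⊥
Uses lab (step {t} {t′} c rest)     a = (lab t t′ c ≡ a) ⊎ Uses lab rest a

OnlyUses : ∀ {s u J} → Labeling s → SatChain s u J → ℕ → ℕ → Set
OnlyUses lab done                   a a′ = ⊤
OnlyUses lab (step {t} {t′} c rest) a a′ =
  ((lab t t′ c ≡ a) ⊎ (lab t t′ c ≡ a′)) × OnlyUses lab rest a a′

IsSBLabeling : (s : List ℕ) → Labeling s → Set
IsSBLabeling s lab =
  ∀ u v w (cv : Cover s u v) (cw : Cover s u w) → v ≢ w →
    (lab u v cv ≢ lab u w cw) ×
    (∀ J → IsJoin s v w J → (ch : SatChain s u J) →
       Uses lab ch (lab u v cv) × Uses lab ch (lab u w cw) ×
       OnlyUses lab ch (lab u v cv) (lab u w cw))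

{-# OPTIONS --safe #-}

-- An s-decreasing tree is determined by its multi-inversion set, and the sets that occur are those that are
-- bounded by s, transitive and planar (#(c,a) > #(c,b) forces #(b,a) = s(b) for a < b < c).  The rotation along
-- an ascent (a,b) adds 1 to (b,x) for x = a and for the x with 0 < #(a,x) < s(a), and does nothing else.
--
-- Let (a,b), (c,d) with a < c be the ascents of two covers v, w of u.  If b ≠ c, the maximum of the inversion sets
-- of v and w is transitive and planar; if b = c, it becomes so after (d,x) is also raised for the labels x moved
-- by the first rotation.  Either way it belongs to a tree R above v ∨ w.  A chain from u to v ∨ w stays below R,
-- so an edge with ascent (a′,b′) must raise a pair (b′,a′) that differs between u and R.  If a′ is neither a nor c,
-- then 0 < #(e,a′) < s(e) with e = a or e = c, where e < b′ and this value is the same in u and R: this contradicts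
-- condition (ii) of a tree ascent.
module Submission where

open import Defs
open import Data.Nat using (ℕ; zero; suc; _+_; _≤_; _<_; _≡ᵇ_; _<ᵇ_; z≤n; s≤s; s<s⁻¹; s≤s⁻¹; _⊓_; _⊔_)
open import Data.Nat.Properties
open import Data.Bool using (Bool; true; false; T; _∧_)
open import Data.Bool.Properties using (T-≡; T-∧; ¬-not; ∧-zeroʳ)
open import Data.List using (List; []; _∷_; _++_; length; map; upTo; applyUpTo)
open import Data.List.Properties using (length-applyUpTo)
open import Data.List.Membership.Propositional using (_∈_; _∉_)
open import Data.List.Membership.Propositional.Properties using (∈-++⁺ˡ; ∈-++⁺ʳ; ∈-++⁻; ∈-map⁺; ∈-map⁻; ∈-upTo⁺; ∈-upTo⁻)
open import Data.List.Membership.Propositional.Properties.WithK using (unique∧set⇒bag)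
open import Data.List.Relation.Binary.BagAndSetEquality using (∼bag⇒↭)
open import Data.List.Relation.Binary.Permutation.Propositional using (↭-sym; ↭⇒↭ₛ)
open import Data.List.Relation.Binary.Permutation.Propositional.Properties using (∈-resp-↭)
open import Data.List.Relation.Binary.Permutation.Setoid.Properties using (Unique-resp-↭)
open import Data.List.Relation.Unary.All as All using (All; []; _∷_)
open import Data.List.Relation.Unary.All.Properties using (++⁻ˡ; ++⁻ʳ)
open import Data.List.Relation.Unary.AllPairs using ([]; _∷_)
open import Data.List.Relation.Unary.Any using (here; there)
open import Data.List.Relation.Unary.Unique.Propositional using (Unique)
open import Data.List.Relation.Unary.Unique.Propositional.Properties using (upTo⁺; map⁺; ++⁺)
open import Data.Maybe using (just; nothing)
open import Data.Maybe.Properties using (just-injective)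
open import Data.Product using (∃-syntax; _×_; _,_; proj₁; proj₂)
open import Data.Sum using (_⊎_; inj₁; inj₂; [_,_]′; swap)
open import Data.Empty using (⊥; ⊥-elim)
open import Data.Unit using (tt)
open import Function.Base using (_∘_; id)
open import Function.Bundles using (Equivalence; mk⇔)
open import Relation.Nullary using (¬_; Dec; yes; no; contradiction)
open import Relation.Nullary.Decidable using (_×-dec_; _⊎-dec_)
open import Relation.Binary.Definitions using (tri<; tri≈; tri>)
open import Relation.Binary.PropositionalEquality using (_≡_; _≢_; refl; sym; trans; cong; subst; setoid)

-- Boolean tests on naturals

≡ᵇ-refl : ∀ n → (n ≡ᵇ n) ≡ true
≡ᵇ-refl n = Equivalence.to T-≡ (≡⇒≡ᵇ n n refl)

≢⇒≡ᵇ-false : ∀ {m n} → m ≢ n → (m ≡ᵇ n) ≡ false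
≢⇒≡ᵇ-false {m} {n} m≢n = ¬-not (m≢n ∘ ≡ᵇ⇒≡ m n ∘ Equivalence.from T-≡)

<⇒<ᵇ-true : ∀ {m n} → m < n → (m <ᵇ n) ≡ true
<⇒<ᵇ-true = Equivalence.to T-≡ ∘ <⇒<ᵇ

≮⇒<ᵇ-false : ∀ {m n} → ¬ m < n → (m <ᵇ n) ≡ false
≮⇒<ᵇ-false {m} {n} m≮n = ¬-not (m≮n ∘ <ᵇ⇒< m n ∘ Equivalence.from T-≡)

-- Root paths

module _ {σ : ℕ} (ps qs : List ℕ) where

  cmp-≡ : ∀ p → cmpPaths σ (p ∷ ps) (p ∷ qs) ≡ cmpPaths σ ps qs
  cmp-≡ p rewrite ≡ᵇ-refl p = refl

  cmp-left : ∀ {p q} → q < p → cmpPaths σ (p ∷ ps) (q ∷ qs) ≡ 0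
  cmp-left q<p rewrite ≢⇒≡ᵇ-false (<⇒≢ q<p ∘ sym) | <⇒<ᵇ-true q<p = refl

  cmp-right : ∀ {p q} → p < q → cmpPaths σ (p ∷ ps) (q ∷ qs) ≡ σ
  cmp-right p<q rewrite ≢⇒≡ᵇ-false (<⇒≢ p<q) | ≮⇒<ᵇ-false (<-asym p<q) = refl

Extends : List ℕ → List ℕ → Set
Extends p q = ∃[ r ] p ≡ q ++ r

extends-∷ : ∀ {p q m} → Extends p q → Extends (m ∷ p) (m ∷ q)
extends-∷ (r , eq) = r , cong (_ ∷_) eq

cmp-below : ∀ σ pb i q → cmpPaths σ pb (pb ++ i ∷ q) ≡ i
cmp-below σ []       i q = refl
cmp-below σ (m ∷ pb) i q = trans (cmp-≡ pb _ m) (cmp-below σ pb i q)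

-- Since `pb` is not a prefix of `pr`, the comparison is decided within `pb`, before `q` is reached.
cmp-++ : ∀ σ pr pb q → ¬ Extends pr pb → cmpPaths σ pr (pb ++ q) ≡ cmpPaths σ pr pb
cmp-++ σ pr       []       q ne = contradiction (pr , refl) ne
cmp-++ σ []       (l ∷ pb) q ne = refl
cmp-++ σ (m ∷ pr) (l ∷ pb) q ne with m ≟ l
... | yes refl rewrite ≡ᵇ-refl m = cmp-++ σ pr pb q (ne ∘ extends-∷)
... | no m≢l rewrite ≢⇒≡ᵇ-false m≢l = refl

-- Follow `pb` and `pa` to where they part. If `pa` turns left, the first alternative holds. If it
-- turns right, its value seen from `pc` cannot drop: either `pb` is left of `pc` and has value 0,
-- or `pa` is right of `pc` and has the value `σc`, which bounds the other by hypothesis.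
cmp-trans : ∀ σb σc pc pb pa → cmpPaths σc pc pb ≤ σc →
            cmpPaths σb pb pa ≡ 0 ⊎ cmpPaths σc pc pb ≤ cmpPaths σc pc pa
cmp-trans σb σc []       []       pa       bd = inj₂ z≤n
cmp-trans σb σc []       (l ∷ pb) []       bd = inj₁ refl
cmp-trans σb σc []       (l ∷ pb) (k ∷ pa) bd with k <? l
... | yes k<l = inj₁ (cmp-left pb pa k<l)
... | no  k≮l = inj₂ (≮⇒≥ k≮l)
cmp-trans σb σc (m ∷ pc) []       pa       bd = inj₂ z≤n
cmp-trans σb σc (m ∷ pc) (l ∷ pb) []       bd = inj₁ refl
cmp-trans σb σc (m ∷ pc) (l ∷ pb) (k ∷ pa) bd with <-cmp l k
... | tri> _ _ k<l = inj₁ (cmp-left pb pa k<l)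
... | tri≈ _ refl _ with m ≟ l
...   | yes refl rewrite ≡ᵇ-refl l = cmp-trans σb σc pc pb pa bd
...   | no  m≢l rewrite ≢⇒≡ᵇ-false m≢l = inj₂ ≤-refl
cmp-trans σb σc (m ∷ pc) (l ∷ pb) (k ∷ pa) bd | tri< l<k _ _ with l <? m
... | yes l<m = inj₂ (≤-trans (≤-reflexive (cmp-left pc pb l<m)) z≤n)
... | no  l≮m = inj₂ (≤-trans bd (≤-reflexive (sym (cmp-right pc pa (≤-<-trans (≮⇒≥ l≮m) l<k)))))

-- The mirror image of `cmp-trans`. The hypothesis on `Extends` says that `pc` does not lie at or
-- below `pb`, the one position where a path through another child of `pb` could get a larger value.
cmp-planar : ∀ σb σc pc pb pa → ¬ Extends pc pb → cmpPaths σc pc pa ≤ σc →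
             cmpPaths σb pb pa ≡ σb ⊎ cmpPaths σc pc pa ≤ cmpPaths σc pc pb
cmp-planar σb σc pc       []       pa       ne bd = contradiction (pc , refl) ne
cmp-planar σb σc []       (l ∷ pb) []       ne bd = inj₂ z≤n
cmp-planar σb σc []       (l ∷ pb) (k ∷ pa) ne bd with l <? k
... | yes l<k = inj₁ (cmp-right pb pa l<k)
... | no  l≮k = inj₂ (≮⇒≥ l≮k)
cmp-planar σb σc (m ∷ pc) (l ∷ pb) []       ne bd = inj₂ z≤n
cmp-planar σb σc (m ∷ pc) (l ∷ pb) (k ∷ pa) ne bd with <-cmp l k
... | tri< l<k _ _ = inj₁ (cmp-right pb pa l<k)
... | tri≈ _ refl _ with m ≟ l
...   | yes refl rewrite ≡ᵇ-refl l = cmp-planar σb σc pc pb pa (ne ∘ extends-∷) bd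
...   | no  m≢l rewrite ≢⇒≡ᵇ-false m≢l = inj₂ ≤-refl
cmp-planar σb σc (m ∷ pc) (l ∷ pb) (k ∷ pa) ne bd | tri> _ _ k<l with k <? m
... | yes k<m = inj₂ (≤-trans (≤-reflexive (cmp-left pc pa k<m)) z≤n)
... | no  k≮m = inj₂ (≤-trans bd (≤-reflexive (sym (cmp-right pc pb (≤-<-trans (≮⇒≥ k≮m) k<l)))))

-- Decreasing trees with distinct labels

data Child : List Tree → ℕ → Tree → Set where
  first : ∀ {t ts} → Child (t ∷ ts) 0 t
  next  : ∀ {t u ts k} → Child ts k t → Child (u ∷ ts) (suc k) t

child⇒childAt : ∀ {ts k t} → Child ts k t → childAt k ts ≡ just t
child⇒childAt first    = refl
child⇒childAt (next c) = child⇒childAt c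

childAt⇒child : ∀ {k t} ts → childAt k ts ≡ just t → Child ts k t
childAt⇒child {zero}  (t ∷ ts) refl = first
childAt⇒child {suc k} (t ∷ ts) eq   = next (childAt⇒child ts eq)

child-unique : ∀ {ts k t t′} → Child ts k t → Child ts k t′ → t ≡ t′
child-unique first    first     = refl
child-unique (next c) (next c′) = child-unique c c′

child-bound : ∀ {ts k t} → Child ts k t → k < length ts
child-bound first    = s≤s z≤n
child-bound (next c) = s≤s (child-bound c)

∈-labelsL⁺ : ∀ {ts k t x} → Child ts k t → x ∈ labels t → x ∈ labelsL ts
∈-labelsL⁺ first                 x∈ = ∈-++⁺ˡ x∈
∈-labelsL⁺ {u ∷ ts} (next c) x∈ = ∈-++⁺ʳ (labels u) (∈-labelsL⁺ c x∈)

∈-labelsL⁻ : ∀ {x} ts → x ∈ labelsL ts → ∃[ k ] ∃[ t ] Child ts k t × x ∈ labels t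
∈-labelsL⁻ (t ∷ ts) x∈ with ∈-++⁻ (labels t) x∈
... | inj₁ x∈t = 0 , t , first , x∈t
... | inj₂ x∈ts with ∈-labelsL⁻ ts x∈ts
...   | k , t′ , c , x∈t′ = suc k , t′ , next c , x∈t′

-- The decreasing shape together with distinctness of labels, stated pointwise over `Child`.
-- Distinctness makes the first-match searches `pathTo` and `subT` find the intended vertex.
data Good (s : List ℕ) : Tree → Set where
  leaf : Good s leaf
  node : ∀ {i ts} →
         length ts ≡ suc (sv s i) →
         (∀ {k t x} → Child ts k t → x ∈ labels t → x < i) →
         (∀ {k l t t′ x} → Child ts k t → Child ts l t′ → x ∈ labels t → x ∈ labels t′ → k ≡ l) →
         (∀ {k t} → Child ts k t → Good s t) →
         Good s (node i ts)

-- In `At T v p us`, the vertex labeled `v` has root path `p` and list of children `us`.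
data At : Tree → ℕ → List ℕ → List Tree → Set where
  here  : ∀ {v ts} → At (node v ts) v [] ts
  there : ∀ {i ts k t v p us} → Child ts k t → At t v p us → At (node i ts) v (k ∷ p) us

at⇒∈ : ∀ {T v p us} → At T v p us → v ∈ labels T
at⇒∈ here                 = here refl
at⇒∈ (there c a) = there (∈-labelsL⁺ c (at⇒∈ a))

mutual
  ∈⇒at : ∀ {v} T → v ∈ labels T → ∃[ p ] ∃[ us ] At T v p us
  ∈⇒at (node i ts) (here refl) = [] , ts , here
  ∈⇒at (node i ts) (there v∈) with ∈⇒atL ts v∈
  ... | k , t , c , p , us , a = k ∷ p , us , there c a

  ∈⇒atL : ∀ {v} ts → v ∈ labelsL ts → ∃[ k ] ∃[ t ] Child ts k t × ∃[ p ] ∃[ us ] At t v p us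
  ∈⇒atL (t ∷ ts) v∈ with ∈-++⁻ (labels t) v∈
  ... | inj₁ v∈t  = 0 , t , first , ∈⇒at t v∈t
  ... | inj₂ v∈ts with ∈⇒atL ts v∈ts
  ...   | k , u , c , r = suc k , u , next c , r

at-++ : ∀ {T v p us k t x q ws} → At T v p us → Child us k t → At t x q ws → At T x (p ++ k ∷ q) ws
at-++ here         c b = there c b
at-++ (there c′ a) c b = there c′ (at-++ a c b)

mutual
  pathTo-∉ : ∀ {v} t → v ∉ labels t → pathTo v t ≡ nothing
  pathTo-∉ leaf v∉ = refl
  pathTo-∉ {v} (node i ts) v∉ rewrite ≢⇒≡ᵇ-false {v} {i} (v∉ ∘ here) = pathToL-∉ 0 ts (v∉ ∘ there)

  pathToL-∉ : ∀ {v} k ts → v ∉ labelsL ts → pathToL v k ts ≡ nothing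
  pathToL-∉ k [] v∉ = refl
  pathToL-∉ k (t ∷ ts) v∉ rewrite pathTo-∉ t (v∉ ∘ ∈-++⁺ˡ) = pathToL-∉ (suc k) ts (v∉ ∘ ∈-++⁺ʳ (labels t))

mutual
  subT-∉ : ∀ {v} t → v ∉ labels t → subT v t ≡ nothing
  subT-∉ leaf v∉ = refl
  subT-∉ {v} (node i ts) v∉ rewrite ≢⇒≡ᵇ-false {v} {i} (v∉ ∘ here) = subTL-∉ ts (v∉ ∘ there)

  subTL-∉ : ∀ {v} ts → v ∉ labelsL ts → subTL v ts ≡ nothing
  subTL-∉ [] v∉ = refl
  subTL-∉ (t ∷ ts) v∉ rewrite subT-∉ t (v∉ ∘ ∈-++⁺ˡ) = subTL-∉ ts (v∉ ∘ ∈-++⁺ʳ (labels t))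

-- Here `k` is the running index of the search. By `only` the search fails in all earlier siblings,
-- so it arrives at child `j` with index `k + j`.
pathToL-child : ∀ {ts v p t j} k → Child ts j t → (∀ {l t′} → Child ts l t′ → v ∈ labels t′ → l ≡ j) →
                pathTo v t ≡ just p → pathToL v k ts ≡ just (k + j ∷ p)
pathToL-child k first only eq rewrite eq | +-identityʳ k = refl
pathToL-child {u ∷ ts} {j = suc j} k (next c) only eq
  rewrite pathTo-∉ u (λ v∈ → 0≢1+n (only first v∈)) | +-suc k j =
  pathToL-child (suc k) c (λ c′ v∈ → suc-injective (only (next c′) v∈)) eq

subTL-child : ∀ {ts v r t j} → Child ts j t → (∀ {l t′} → Child ts l t′ → v ∈ labels t′ → l ≡ j) →
              subT v t ≡ just r → subTL v ts ≡ just r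
subTL-child first only eq rewrite eq = refl
subTL-child {u ∷ ts} (next c) only eq
  rewrite subT-∉ u (λ v∈ → 0≢1+n (only first v∈)) =
  subTL-child c (λ c′ v∈ → suc-injective (only (next c′) v∈)) eq

at⇒pathTo : ∀ {s T v p us} → Good s T → At T v p us → pathTo v T ≡ just p
at⇒pathTo {v = v} g here rewrite ≡ᵇ-refl v = refl
at⇒pathTo {v = v} (node {i} {ts} _ below disj good) (there c a)
  rewrite ≢⇒≡ᵇ-false {v} {i} (<⇒≢ (below c (at⇒∈ a))) =
  pathToL-child 0 c (λ c′ v∈ → disj c′ c v∈ (at⇒∈ a)) (at⇒pathTo (good c) a)

at⇒subT : ∀ {s T v p us} → Good s T → At T v p us → subT v T ≡ just (node v us)
at⇒subT {v = v} g here rewrite ≡ᵇ-refl v = refl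
at⇒subT {v = v} (node {i} {ts} _ below disj good) (there c a)
  rewrite ≢⇒≡ᵇ-false {v} {i} (<⇒≢ (below c (at⇒∈ a))) =
  subTL-child c (λ c′ v∈ → disj c′ c v∈ (at⇒∈ a)) (at⇒subT (good c) a)

mutual
  subT⇒at : ∀ {v r} T → subT v T ≡ just r → ∃[ p ] ∃[ us ] At T v p us × r ≡ node v us
  subT⇒at {v} (node i ts) eq with v ≟ i
  ... | yes refl rewrite ≡ᵇ-refl v = [] , ts , here , sym (just-injective eq)
  ... | no v≢i rewrite ≢⇒≡ᵇ-false v≢i with subTL⇒at ts eq
  ...   | k , t , c , p , us , a , req = k ∷ p , us , there c a , req

  subTL⇒at : ∀ {v r} ts → subTL v ts ≡ just r →
             ∃[ k ] ∃[ t ] Child ts k t × ∃[ p ] ∃[ us ] At t v p us × r ≡ node v us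
  subTL⇒at {v} (t ∷ ts) eq with subT v t in eq′
  subTL⇒at {v} (t ∷ ts) refl | just r = 0 , t , first , subT⇒at t eq′
  ... | nothing with subTL⇒at ts eq
  ...   | k , t′ , c , rest = suc k , t′ , next c , rest

-- x ∈ T^v_j in the notation of the paper.
Below : Tree → ℕ → ℕ → ℕ → Set
Below T v j x = ∃[ p ] ∃[ us ] ∃[ t ] At T v p us × Child us j t × x ∈ labels t

below⇒inChild : ∀ {s T v j x} → Good s T → Below T v j x → InChild T v j x
below⇒inChild g (p , us , t , a , c , x∈) rewrite at⇒subT g a = t , child⇒childAt c , x∈

inChild⇒below : ∀ {T v j x} → InChild T v j x → Below T v j x
inChild⇒below {T} {v} (t , eq , x∈) with subT v T in eq′
... | just r with subT⇒at T eq′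
...   | p , us , a , refl = p , us , t , a , childAt⇒child us eq , x∈

below-lift : ∀ {i ts k t v j x} → Child ts k t → Below t v j x → Below (node i ts) v j x
below-lift c (p , us , t′ , a , c′ , x∈) = _ ∷ p , us , t′ , there c a , c′ , x∈

-- e is the lowest common ancestor of x and y.
Separated : Tree → ℕ → ℕ → Set
Separated T y x = ∃[ e ] ∃[ j ] ∃[ k ] y < e × Below T e j y × Below T e k x × j ≢ k

-- Inversion numbers read off root paths

module _ {s : List ℕ} where

  inv-at : ∀ {T y x p q us ws} → Good s T → At T y p us → At T x q ws →
           inv s T y x ≡ cmpPaths (sv s y) p q
  inv-at g a b rewrite at⇒pathTo g a | at⇒pathTo g b = refl

  label-≤-root : ∀ {i ts x} → Good s (node i ts) → x ∈ labels (node i ts) → x ≤ i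
  label-≤-root g (here refl) = ≤-refl
  label-≤-root (node {ts = ts} _ below _ _) (there x∈) with ∈-labelsL⁻ ts x∈
  ... | k , t , c , x∈t = <⇒≤ (below c x∈t)

  -- A path that extends `p` ends in the subtree rooted at `b`, where no label exceeds `b`.
  extension-≤ : ∀ {T b c p q r us ws} → Good s T → At T b p us → At T c q ws → q ≡ p ++ r → c ≤ b
  extension-≤ g here a′ eq = label-≤-root g (at⇒∈ a′)
  extension-≤ (node _ _ _ good) (there c a) (there c′ a′) refl with child-unique c c′
  ... | refl = extension-≤ (good c) a a′ refl

  ¬extends : ∀ {T b c p q us ws} → Good s T → b < c → At T b p us → At T c q ws → ¬ Extends q p
  ¬extends g b<c a a′ (r , eq) = <⇒≱ b<c (extension-≤ g a a′ eq)

  cmp-bound : ∀ {T y x p q us ws} → Good s T → At T y p us → At T x q ws →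
              cmpPaths (sv s y) p q ≤ sv s y
  cmp-bound g here here = z≤n
  -- A vertex `y` has `s(y) + 1` children, so the last index is `s(y)`.
  cmp-bound (node len _ _ _) here (there c b) = ≤-pred (≤-trans (child-bound c) (≤-reflexive len))
  cmp-bound g (there c a) here = z≤n
  cmp-bound (node _ _ _ good) (there {k = k} {p = p} c a) (there {k = l} {p = q} c′ b) with <-cmp k l
  ... | tri< k<l _ _ = ≤-reflexive (cmp-right p q k<l)
  ... | tri> _ _ l<k = ≤-trans (≤-reflexive (cmp-left p q l<k)) z≤n
  ... | tri≈ _ refl _ with child-unique c c′
  ...   | refl = ≤-trans (≤-reflexive (cmp-≡ p q k)) (cmp-bound (good c) a b)

  module _ {T : Tree} (g : Good s T) where

    inv-bound : ∀ {y x} → y ∈ labels T → x ∈ labels T → inv s T y x ≤ sv s y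
    inv-bound y∈ x∈ with ∈⇒at T y∈ | ∈⇒at T x∈
    ... | _ , _ , a | _ , _ , b rewrite inv-at g a b = cmp-bound g a b

    inv-transitive : ∀ {a b c} → a ∈ labels T → b ∈ labels T → c ∈ labels T →
                     inv s T b a ≡ 0 ⊎ inv s T c b ≤ inv s T c a
    inv-transitive a∈ b∈ c∈ with ∈⇒at T a∈ | ∈⇒at T b∈ | ∈⇒at T c∈
    ... | pa , _ , α | pb , _ , β | pc , _ , γ
      rewrite inv-at g β α | inv-at g γ β | inv-at g γ α = cmp-trans _ _ pc pb pa (cmp-bound g γ β)

    inv-planar : ∀ {a b c} → a ∈ labels T → b ∈ labels T → c ∈ labels T → b < c →
                 inv s T b a ≡ sv s b ⊎ inv s T c a ≤ inv s T c b
    inv-planar a∈ b∈ c∈ b<c with ∈⇒at T a∈ | ∈⇒at T b∈ | ∈⇒at T c∈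
    ... | pa , _ , α | pb , _ , β | pc , _ , γ
      rewrite inv-at g β α | inv-at g γ β | inv-at g γ α =
      cmp-planar _ _ pc pb pa (¬extends g b<c β γ) (cmp-bound g γ α)

    inv-below : ∀ {b i a} → Below T b i a → inv s T b a ≡ i
    inv-below (p , us , t , β , c , a∈) with ∈⇒at t a∈
    ... | q , _ , α rewrite inv-at g β (at-++ β c α) = cmp-below _ p _ q

    -- The path of `a` extends that of `b`, and a larger label `r` is no descendant of `b`, so the
    -- comparison with `r` is decided along the path of `b`.
    inv-above : ∀ {b i a r} → Below T b i a → r ∈ labels T → b < r → inv s T r a ≡ inv s T r b
    inv-above (p , us , t , β , c , a∈) r∈ b<r with ∈⇒at t a∈ | ∈⇒at T r∈
    ... | q , _ , α | pr , _ , ρ rewrite inv-at g ρ (at-++ β c α) | inv-at g ρ β =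
      cmp-++ _ pr p _ (¬extends g b<r β ρ)

  below-or-separated : ∀ {T y x p q us ws} → Good s T → x < y → At T y p us → At T x q ws →
                       (∃[ j ] Below T y j x) ⊎ Separated T y x
  below-or-separated g x<y here here = contradiction x<y (<-irrefl refl)
  below-or-separated g x<y here (there c b) = inj₁ (_ , [] , _ , _ , here , c , at⇒∈ b)
  below-or-separated (node _ below _ _) x<y (there c a) here = contradiction (below c (at⇒∈ a)) (<-asym x<y)
  below-or-separated (node _ below _ good) x<y (there {k = k} c a) (there {k = l} c′ b) with k ≟ l
  ... | no k≢l = inj₂ (_ , k , l , below c (at⇒∈ a) , ([] , _ , _ , here , c , at⇒∈ a)
                                                   , ([] , _ , _ , here , c′ , at⇒∈ b) , k≢l)
  ... | yes refl with child-unique c c′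
  ...   | refl with below-or-separated (good c) x<y a b
  ...     | inj₁ (j , β) = inj₁ (j , below-lift c β)
  ...     | inj₂ (e , j , j′ , y<e , β , β′ , j≢) = inj₂ (e , j , j′ , y<e , below-lift c β , below-lift c β′ , j≢)

-- Passage between `IsSTree` and `Good`

unique-++⁻ : ∀ {A : Set} xs {ys : List A} → Unique (xs ++ ys) →
             Unique xs × Unique ys × (∀ {x} → x ∈ xs → x ∈ ys → ⊥)
unique-++⁻ []       u = [] , u , λ ()
unique-++⁻ (x ∷ xs) (x≢ ∷ u) with unique-++⁻ xs u
... | uxs , uys , dis = ++⁻ˡ xs x≢ ∷ uxs , uys , λ where
  (here refl) y∈ → All.lookup (++⁻ʳ xs x≢) y∈ refl
  (there x∈)  y∈ → dis x∈ y∈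

all-child⁻ : ∀ {P : Tree → Set} {ts k t} → All P ts → Child ts k t → P t
all-child⁻ (p ∷ ps) first    = p
all-child⁻ (p ∷ ps) (next c) = all-child⁻ ps c

all-child⁺ : ∀ {P : Tree → Set} ts → (∀ {k t} → Child ts k t → P t) → All P ts
all-child⁺ []       f = []
all-child⁺ (t ∷ ts) f = f first ∷ all-child⁺ ts (f ∘ next)

unique-disjoint : ∀ {k l t t′ x} ts → Unique (labelsL ts) → Child ts k t → Child ts l t′ →
                  x ∈ labels t → x ∈ labels t′ → k ≡ l
unique-disjoint (t ∷ ts) u c c′ x∈ x∈′ with c | c′ | unique-++⁻ (labels t) u
... | first  | first   | _ = refl
... | first  | next d′ | _ , _ , dis = ⊥-elim (dis x∈ (∈-labelsL⁺ d′ x∈′))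
... | next d | first   | _ , _ , dis = ⊥-elim (dis x∈′ (∈-labelsL⁺ d x∈))
... | next d | next d′ | _ , us , _ = cong suc (unique-disjoint ts us d d′ x∈ x∈′)

unique-labelsL : ∀ ts → (∀ {k t} → Child ts k t → Unique (labels t)) →
                 (∀ {k l t t′ x} → Child ts k t → Child ts l t′ → x ∈ labels t → x ∈ labels t′ → k ≡ l) →
                 Unique (labelsL ts)
unique-labelsL []       u disj = []
unique-labelsL (t ∷ ts) u disj =
  ++⁺ (u first)
      (unique-labelsL ts (u ∘ next) (λ c c′ x∈ x∈′ → suc-injective (disj (next c) (next c′) x∈ x∈′)))
      (λ (x∈t , x∈ts) → let k , t′ , c , x∈t′ = ∈-labelsL⁻ ts x∈ts in 0≢1+n (disj first (next c) x∈t x∈t′))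

module _ {s : List ℕ} where

  mutual
    shape⇒good : ∀ {T} → DecShape s T → Unique (labels T) → Good s T
    shape⇒good leaf u = leaf
    shape⇒good (node i ts len below shapes) (_ ∷ u) =
      node len (λ c x∈ → All.lookup (all-child⁻ below c) x∈) (unique-disjoint ts u) (shape⇒goodL shapes u)

    shape⇒goodL : ∀ {ts k t} → All (DecShape s) ts → Unique (labelsL ts) → Child ts k t → Good s t
    shape⇒goodL {t ∷ ts} (d ∷ ds) u first = shape⇒good d (proj₁ (unique-++⁻ (labels t) u))
    shape⇒goodL {t ∷ ts} (d ∷ ds) u (next c)  = shape⇒goodL ds (proj₁ (proj₂ (unique-++⁻ (labels t) u))) c

  good⇒shape : ∀ {T} → Good s T → DecShape s T
  good⇒shape leaf = leaf
  good⇒shape (node {i} {ts} len below disj good) =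
    node i ts len (all-child⁺ ts (λ c → All.tabulate (below c))) (all-child⁺ ts (λ c → good⇒shape (good c)))

  good⇒unique : ∀ {T} → Good s T → Unique (labels T)
  good⇒unique leaf = []
  good⇒unique (node {i} {ts} len below disj good) =
    All.tabulate (λ x∈ → let k , t , c , x∈t = ∈-labelsL⁻ ts x∈ in <⇒≢ (below c x∈t) ∘ sym)
    ∷ unique-labelsL ts (λ c → good⇒unique (good c)) disj

  range-unique : ∀ n → Unique (map suc (upTo n))
  range-unique n = map⁺ suc-injective (upTo⁺ n)

  sTree⇒good : ∀ {T} → IsSTree s T → Good s T
  sTree⇒good (d , perm) = shape⇒good d (Unique-resp-↭ (setoid ℕ) (↭⇒↭ₛ (↭-sym perm)) (range-unique (length s)))

  sTree-∈ : ∀ {T x} → IsSTree s T → 1 ≤ x → x ≤ length s → x ∈ labels T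
  sTree-∈ {x = suc x} (_ , perm) _ x<n = ∈-resp-↭ (↭-sym perm) (∈-map⁺ suc (∈-upTo⁺ x<n))

  sTree-range : ∀ {T x} → IsSTree s T → x ∈ labels T → 1 ≤ x × x ≤ length s
  sTree-range (_ , perm) x∈ with ∈-map⁻ suc (∈-resp-↭ perm x∈)
  ... | _ , y∈ , refl = s≤s z≤n , ∈-upTo⁻ y∈

  good⇒sTree : ∀ {T} → Good s T → (∀ {x} → x ∈ labels T → 1 ≤ x × x ≤ length s) →
               (∀ {x} → 1 ≤ x → x ≤ length s → x ∈ labels T) → IsSTree s T
  good⇒sTree {T} g sound complete =
    good⇒shape g , ∼bag⇒↭ (unique∧set⇒bag (good⇒unique g) (range-unique _) (mk⇔ to from))
    where
    to : ∀ {x} → x ∈ labels T → x ∈ map suc (upTo (length s))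
    to {zero}  x∈ = contradiction (proj₁ (sound x∈)) 1+n≰n
    to {suc x} x∈ = ∈-map⁺ suc (∈-upTo⁺ (proj₂ (sound x∈)))
    from : ∀ {x} → x ∈ map suc (upTo (length s)) → x ∈ labels T
    from x∈ with ∈-map⁻ suc x∈
    ... | _ , y∈ , refl = complete (s≤s z≤n) (∈-upTo⁻ y∈)

  -- A tree is determined by its inversion numbers

  good-child : ∀ {i ts k t} → Good s (node i ts) → Child ts k t → Good s t
  good-child (node _ _ _ good) = good

  module _ {i ts} (g : Good s (node i ts)) where

    inv-root : ∀ {k t x} → Child ts k t → x ∈ labels t → inv s (node i ts) i x ≡ k
    inv-root c x∈ = inv-below g ([] , ts , _ , here , c , x∈)

    inv-child : ∀ {k t x y} → Child ts k t → y ∈ labels t → x ∈ labels t →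
                inv s (node i ts) y x ≡ inv s t y x
    inv-child {k} {t} c y∈ x∈ with ∈⇒at t y∈ | ∈⇒at t x∈
    ... | p , _ , β | q , _ , α =
      trans (inv-at g (there c β) (there c α)) (trans (cmp-≡ p q k) (sym (inv-at (good-child g c) β α)))

    inv-left : ∀ {k l t t′ x y} → Child ts k t → Child ts l t′ → y ∈ labels t → x ∈ labels t′ → l < k →
               inv s (node i ts) y x ≡ 0
    inv-left {t = t} {t′} c c′ y∈ x∈ l<k with ∈⇒at t y∈ | ∈⇒at t′ x∈
    ... | p , _ , β | q , _ , α = trans (inv-at g (there c β) (there c′ α)) (cmp-left p q l<k)

    inv-right : ∀ {k l t t′ x y} → Child ts k t → Child ts l t′ → y ∈ labels t → x ∈ labels t′ → k < l →
                inv s (node i ts) y x ≡ sv s y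
    inv-right {t = t} {t′} c c′ y∈ x∈ k<l with ∈⇒at t y∈ | ∈⇒at t′ x∈
    ... | p , _ , β | q , _ , α = trans (inv-at g (there c β) (there c′ α)) (cmp-right p q k<l)

  children-ext : ∀ ts ts′ → length ts ≡ length ts′ →
                 (∀ {k t t′} → Child ts k t → Child ts′ k t′ → t ≡ t′) → ts ≡ ts′
  children-ext []       []         len f = refl
  children-ext (t ∷ ts) (t′ ∷ ts′) len f
    with refl ← f first first
       | refl ← children-ext ts ts′ (suc-injective len) (λ c c′ → f (next c) (next c′)) = refl

  -- The inversion number of the root with `x` is the index of the child containing `x`, so equal
  -- numbers put `x` under the same index.
  child-member : ∀ {i ts ts′ k t t′ x} → Good s (node i ts) → Good s (node i ts′) →
                 (∀ {x} → x ∈ labels (node i ts) → x ∈ labels (node i ts′)) →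
                 (∀ {y x} → y ∈ labels (node i ts) → x ∈ labels (node i ts) → x < y →
                   inv s (node i ts) y x ≡ inv s (node i ts′) y x) →
                 Child ts k t → Child ts′ k t′ → x ∈ labels t → x ∈ labels t′
  child-member {i} {ts} {ts′} {k} {t} {t′} {x} g@(node _ below _ _) g′ sub agree c c′ x∈
    with sub (there (∈-labelsL⁺ c x∈))
  ... | here refl = contradiction (below c x∈) (<-irrefl refl)
  ... | there x∈′ with ∈-labelsL⁻ ts′ x∈′
  ...   | l , t″ , c″ , x∈t″ = subst (x ∈_) (cong labels (child-unique c″ (subst (λ j → Child ts′ j t′) k≡l c′))) x∈t″
    where
    k≡l : k ≡ l
    k≡l = trans (sym (inv-root g c x∈))
                (trans (agree (here refl) (there (∈-labelsL⁺ c x∈)) (below c x∈)) (inv-root g′ c″ x∈t″))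

  -- Both roots are the largest label. By `child-member` in both directions corresponding children
  -- have the same labels, and `inv-child` passes the agreement on to them.
  inv-injective : ∀ {T T′} → Good s T → Good s T′ →
                  (∀ {x} → x ∈ labels T → x ∈ labels T′) → (∀ {x} → x ∈ labels T′ → x ∈ labels T) →
                  (∀ {y x} → y ∈ labels T → x ∈ labels T → x < y → inv s T y x ≡ inv s T′ y x) →
                  T ≡ T′
  inv-injective leaf leaf sub sup agree = refl
  inv-injective leaf (node _ _ _ _) sub sup agree with () ← sup (here refl)
  inv-injective (node _ _ _ _) leaf sub sup agree with () ← sub (here refl)
  inv-injective g@(node {i} {ts} len below _ good) g′@(node {i′} {ts′} len′ below′ _ good′) sub sup agree
    with refl ← ≤-antisym (label-≤-root g′ (sub (here refl))) (label-≤-root g (sup (here refl))) =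
    cong (node i) (children-ext ts ts′ (trans len (sym len′)) same)
    where
    same : ∀ {k t t′} → Child ts k t → Child ts′ k t′ → t ≡ t′
    same {k} {t} {t′} c c′ = inv-injective (good c) (good′ c′) sub′ sup′ agree′
      where
      sub′ : ∀ {x} → x ∈ labels t → x ∈ labels t′
      sub′ = child-member g g′ sub agree c c′
      sup′ : ∀ {x} → x ∈ labels t′ → x ∈ labels t
      sup′ = child-member g′ g sup (λ y∈ x∈ x<y → sym (agree (sup y∈) (sup x∈) x<y)) c′ c
      agree′ : ∀ {y x} → y ∈ labels t → x ∈ labels t → x < y → inv s t y x ≡ inv s t′ y x
      agree′ y∈ x∈ x<y =
        trans (sym (inv-child g c y∈ x∈))
          (trans (agree (there (∈-labelsL⁺ c y∈)) (there (∈-labelsL⁺ c x∈)) x<y)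
            (inv-child g′ c′ (sub′ y∈) (sub′ x∈)))

  sTree-injective : ∀ {T T′} → IsSTree s T → IsSTree s T′ →
                    (∀ {y x} → 1 ≤ x → x < y → y ≤ length s → inv s T y x ≡ inv s T′ y x) → T ≡ T′
  sTree-injective st st′ agree =
    inv-injective (sTree⇒good st) (sTree⇒good st′)
      (λ x∈ → let 1≤x , x≤n = sTree-range st x∈ in sTree-∈ st′ 1≤x x≤n)
      (λ x∈ → let 1≤x , x≤n = sTree-range st′ x∈ in sTree-∈ st 1≤x x≤n)
      (λ y∈ x∈ x<y → agree (proj₁ (sTree-range st x∈)) x<y (proj₂ (sTree-range st y∈)))

-- Trees from inversion sets

record TreeLike (s : List ℕ) (I : MIS) : Set where
  field
    bounded    : ∀ {x y} → 1 ≤ x → x < y → y ≤ length s → I y x ≤ sv s y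
    transitive : Transitive (length s) I
    planar     : ∀ a b c → 1 ≤ a → a < b → b < c → c ≤ length s → I b a ≡ sv s b ⊎ I c a ≤ I c b

inv-treeLike : ∀ {s T} → IsSTree s T → TreeLike s (inv s T)
inv-treeLike {s} {T} st = record
  { bounded    = λ 1≤x x<y y≤n → inv-bound g (mem (≤-trans 1≤x (<⇒≤ x<y)) y≤n) (mem 1≤x (≤-trans (<⇒≤ x<y) y≤n))
  ; transitive = λ a b c 1≤a a<b b<c c≤n →
      inv-transitive g (mem 1≤a (≤-trans (<⇒≤ (<-trans a<b b<c)) c≤n))
                       (mem (≤-trans 1≤a (<⇒≤ a<b)) (≤-trans (<⇒≤ b<c) c≤n))
                       (mem (≤-trans 1≤a (<⇒≤ (<-trans a<b b<c))) c≤n)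
  ; planar     = λ a b c 1≤a a<b b<c c≤n →
      inv-planar g (mem 1≤a (≤-trans (<⇒≤ (<-trans a<b b<c)) c≤n))
                   (mem (≤-trans 1≤a (<⇒≤ a<b)) (≤-trans (<⇒≤ b<c) c≤n))
                   (mem (≤-trans 1≤a (<⇒≤ (<-trans a<b b<c))) c≤n) b<c
  }
  where
  g = sTree⇒good st
  mem : ∀ {x} → 1 ≤ x → x ≤ length s → x ∈ labels T
  mem = sTree-∈ st

child-applyUpTo⁺ : ∀ {k m} (f : ℕ → Tree) → k < m → Child (applyUpTo f m) k (f k)
child-applyUpTo⁺ {zero}  {suc m} f _   = first
child-applyUpTo⁺ {suc k} {suc m} f k<m = next (child-applyUpTo⁺ (f ∘ suc) (s<s⁻¹ k<m))

child-applyUpTo⁻ : ∀ {k t} m (f : ℕ → Tree) → Child (applyUpTo f m) k t → t ≡ f k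
child-applyUpTo⁻ (suc m) f first    = refl
child-applyUpTo⁻ (suc m) f (next c) = child-applyUpTo⁻ m (f ∘ suc) c

module _ {s : List ℕ} {I : MIS} (tl : TreeLike s I) where

  open TreeLike tl

  -- The predicate `P` accumulates the child indices prescribed by the roots chosen so far, so that
  -- the recursion can run on the bound `m` alone.
  record Grown (m : ℕ) (P : ℕ → Bool) : Set where
    field
      tree     : Tree
      good     : Good s tree
      sound    : ∀ {x} → x ∈ labels tree → 1 ≤ x × x ≤ m × T (P x)
      complete : ∀ {x} → 1 ≤ x → x ≤ m → T (P x) → x ∈ labels tree
      agrees   : ∀ {y x} → y ∈ labels tree → x ∈ labels tree → x < y → inv s tree y x ≡ I y x

  -- The labels x ≤ m with P x; the largest one is the root and x goes to its child number I root x.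
  grow : ∀ m → m ≤ length s → (P : ℕ → Bool) → Grown m P
  grow zero m≤n P = record
    { tree = leaf ; good = leaf ; sound = λ () ; agrees = λ ()
    ; complete = λ 1≤x x≤0 _ → contradiction (≤-trans 1≤x x≤0) 1+n≰n }
  grow (suc m) m<n P with P (suc m) in root?
  ... | false = record
    { tree = tree ; good = good ; agrees = agrees
    ; sound = λ x∈ → let 1≤x , x≤m , px = sound x∈ in 1≤x , m≤n⇒m≤1+n x≤m , px
    ; complete = λ 1≤x x≤1+m px → complete 1≤x (s≤s⁻¹ (≤∧≢⇒< x≤1+m λ where refl → subst T root? px)) px }
    where open Grown (grow m (<⇒≤ m<n) P)
  ... | true = record
    { tree = node (suc m) ts ; good = g ; sound = sound′ ; complete = complete′ ; agrees = agrees′ }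
    where
    open Grown
    part : ℕ → ℕ → Bool
    part k x = P x ∧ (I (suc m) x ≡ᵇ k)
    sub : ∀ k → Grown m (part k)
    sub k = grow m (<⇒≤ m<n) (part k)
    ts : List Tree
    ts = applyUpTo (tree ∘ sub) (suc (sv s (suc m)))
    child-sound : ∀ {k t x} → Child ts k t → x ∈ labels t → 1 ≤ x × x ≤ m × T (P x) × I (suc m) x ≡ k
    child-sound {k} {x = x} c x∈ with refl ← child-applyUpTo⁻ _ (tree ∘ sub) c =
      let 1≤x , x≤m , pxk = sound (sub k) x∈
          px , eq = Equivalence.to T-∧ pxk
      in 1≤x , x≤m , px , ≡ᵇ⇒≡ (I (suc m) x) k eq
    child-good : ∀ {k t} → Child ts k t → Good s t
    child-good {k} c with refl ← child-applyUpTo⁻ _ (tree ∘ sub) c = good (sub k)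
    child-agrees : ∀ {k t y x} → Child ts k t → y ∈ labels t → x ∈ labels t → x < y → inv s t y x ≡ I y x
    child-agrees {k} c with refl ← child-applyUpTo⁻ _ (tree ∘ sub) c = agrees (sub k)
    below : ∀ {k t x} → Child ts k t → x ∈ labels t → x < suc m
    below c x∈ = s≤s (proj₁ (proj₂ (child-sound c x∈)))
    value : ∀ {k t x} → Child ts k t → x ∈ labels t → I (suc m) x ≡ k
    value c x∈ = proj₂ (proj₂ (proj₂ (child-sound c x∈)))
    g : Good s (node (suc m) ts)
    g = node (length-applyUpTo (tree ∘ sub) _) below (λ c c′ x∈ x∈′ → trans (sym (value c x∈)) (value c′ x∈′)) child-good
    sound′ : ∀ {x} → x ∈ labels (node (suc m) ts) → 1 ≤ x × x ≤ suc m × T (P x)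
    sound′ (here refl) = s≤s z≤n , ≤-refl , Equivalence.from T-≡ root?
    sound′ (there x∈) with k , t , c , x∈t ← ∈-labelsL⁻ ts x∈ =
      let 1≤x , x≤m , px , _ = child-sound c x∈t in 1≤x , m≤n⇒m≤1+n x≤m , px
    complete′ : ∀ {x} → 1 ≤ x → x ≤ suc m → T (P x) → x ∈ labels (node (suc m) ts)
    complete′ {x} 1≤x x≤1+m px with x ≟ suc m
    ... | yes refl = here refl
    -- `bounded` guarantees that the prescribed child index exists.
    ... | no x≢ = there (∈-labelsL⁺ (child-applyUpTo⁺ (tree ∘ sub) (s≤s (bounded 1≤x x<1+m m<n)))
                    (complete (sub (I (suc m) x)) 1≤x (s≤s⁻¹ x<1+m)
                      (Equivalence.from T-∧ (px , ≡⇒≡ᵇ (I (suc m) x) _ refl))))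
      where x<1+m = ≤∧≢⇒< x≤1+m x≢
    agrees′ : ∀ {y x} → y ∈ labels (node (suc m) ts) → x ∈ labels (node (suc m) ts) → x < y →
              inv s (node (suc m) ts) y x ≡ I y x
    agrees′ y∈ (here refl) x<y = contradiction (label-≤-root g y∈) (<⇒≱ x<y)
    agrees′ (here refl) (there x∈) x<y with k , t , c , x∈t ← ∈-labelsL⁻ ts x∈ =
      trans (inv-root g c x∈t) (sym (value c x∈t))
    agrees′ {y} {x} (there y∈) (there x∈) x<y
      with k , t , c , y∈t ← ∈-labelsL⁻ ts y∈ | l , t′ , c′ , x∈t′ ← ∈-labelsL⁻ ts x∈ with <-cmp k l
    ... | tri≈ _ refl _ with refl ← child-unique c c′ = trans (inv-child g c y∈t x∈t′) (child-agrees c y∈t x∈t′ x<y)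
    -- For labels in different children of the root, planarity at the root forces `s(y)` when `x` is
    -- on the right, and transitivity forces 0 when it is on the left.
    ... | tri< k<l _ _ = trans (inv-right g c c′ y∈t x∈t′ k<l)
        ([ sym , (λ le → contradiction k<l (≤⇒≯ (≤-trans (≤-reflexive (sym (value c′ x∈t′)))
                                                         (≤-trans le (≤-reflexive (value c y∈t)))))) ]′
          (planar x y (suc m) (proj₁ (child-sound c′ x∈t′)) x<y (below c y∈t) m<n))
    ... | tri> _ _ l<k = trans (inv-left g c c′ y∈t x∈t′ l<k)
        ([ sym , (λ le → contradiction l<k (≤⇒≯ (≤-trans (≤-reflexive (sym (value c y∈t)))
                                                         (≤-trans le (≤-reflexive (value c′ x∈t′)))))) ]′
          (transitive x y (suc m) (proj₁ (child-sound c′ x∈t′)) x<y (below c y∈t) m<n))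

  treeLike⇒sTree : ∃[ U ] IsSTree s U ×
                   (∀ {x y} → 1 ≤ x → x < y → y ≤ length s → inv s U y x ≡ I y x)
  treeLike⇒sTree = tree , good⇒sTree good (λ x∈ → let 1≤x , x≤n , _ = sound x∈ in 1≤x , x≤n) (λ 1≤x x≤n → complete 1≤x x≤n _)
                 , λ 1≤x x<y y≤n → agrees (complete (≤-trans 1≤x (<⇒≤ x<y)) y≤n _) (complete 1≤x (≤-trans (<⇒≤ x<y) y≤n) _) x<y
    where open Grown (grow (length s) ≤-refl (λ _ → true))

choose : ∀ {P A : Set} → Dec P → A → A → A
choose (yes _) u v = u
choose (no _)  u v = v

module _ {P A : Set} {u v : A} where

  choose-yes : (d : Dec P) → P → choose d u v ≡ u
  choose-yes (yes _) p = refl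
  choose-yes (no ¬p) p = contradiction p ¬p

  choose-no : (d : Dec P) → ¬ P → choose d u v ≡ v
  choose-no (yes p) ¬p = contradiction p ¬p
  choose-no (no _)  ¬p = refl

-- Rotations

module _ {b a : ℕ} where

  single-here : single b a b a ≡ 1
  single-here rewrite ≡ᵇ-refl b | ≡ᵇ-refl a = refl

  single-≤1 : ∀ y x → single b a y x ≤ 1
  single-≤1 y x with y ≡ᵇ b | x ≡ᵇ a
  ... | true  | true  = ≤-refl
  ... | true  | false = z≤n
  ... | false | _     = z≤n

  single-elsewhere : ∀ {y x} → ¬ (y ≡ b × x ≡ a) → single b a y x ≡ 0
  single-elsewhere {y} {x} ¬eq with y ≟ b
  ... | no y≢b rewrite ≢⇒≡ᵇ-false y≢b = refl
  ... | yes refl rewrite ≢⇒≡ᵇ-false {x} {a} (λ x≡a → ¬eq (refl , x≡a)) | ∧-zeroʳ (y ≡ᵇ b) = refl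

module _ (s : List ℕ) where

  private n = length s

  -- The labels carried along by a rotation at a: a itself and those below its children 1,…,s(a)−1.
  Moved : MIS → ℕ → ℕ → Set
  Moved I a x = x ≡ a ⊎ (x < a × 0 < I a x × I a x < sv s a)

  moved? : ∀ I a x → Dec (Moved I a x)
  moved? I a x = (x ≟ a) ⊎-dec ((x <? a) ×-dec ((0 <? I a x) ×-dec (I a x <? sv s a)))

  moved-≤ : ∀ I {a x} → Moved I a x → x ≤ a
  moved-≤ I (inj₁ refl)      = ≤-refl
  moved-≤ I (inj₂ (x<a , _)) = <⇒≤ x<a

  -- As `I a x` lies strictly between 0 and `s(a)`, the first alternatives of planarity and of
  -- transitivity both fail, which leaves the two opposite inequalities.
  moved-level : ∀ {I a x r} → TreeLike s I → 1 ≤ x → Moved I a x → a < r → r ≤ n → I r x ≡ I r a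
  moved-level tl 1≤x (inj₁ refl) a<r r≤n = refl
  moved-level {a = a} {x} {r} tl 1≤x (inj₂ (x<a , 0<i , i<s)) a<r r≤n = ≤-antisym
    ([ (λ eq → contradiction eq (<⇒≢ i<s)) , id ]′ (planar x a r 1≤x x<a a<r r≤n))
    ([ (λ eq → contradiction eq (>⇒≢ 0<i)) , id ]′ (transitive x a r 1≤x x<a a<r r≤n))
    where open TreeLike tl

  -- What a tree ascent implies for inversion numbers: `gap` and `level` come from condition (i),
  -- `noMid` is condition (ii) for the values strictly between 0 and `s(e)`, and `right` comes from
  -- the leaf in condition (iii).
  record Ascends (I : MIS) (a b : ℕ) : Set where
    field
      1≤a   : 1 ≤ a
      a<b   : a < b
      b≤n   : b ≤ n
      gap   : I b a < sv s b
      level : ∀ {r} → b < r → r ≤ n → I r a ≡ I r b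
      noMid : ∀ {e} → a < e → e < b → 0 < I e a → I e a < sv s e → ⊥
      right : ∀ {p} → 1 ≤ p → p < a → I a p ≡ sv s a → 0 < sv s a → I b a < I b p
    1≤b : 1 ≤ b
    1≤b = ≤-trans 1≤a (<⇒≤ a<b)

  record Rotates (I I′ : MIS) (a b : ℕ) : Set where
    field
      ascends : Ascends I a b
      raised  : ∀ {x} → 1 ≤ x → Moved I a x → I′ b x ≡ suc (I b x)
      kept    : ∀ {y x} → 1 ≤ x → x < y → y ≤ n → ¬ (y ≡ b × Moved I a x) → I′ y x ≡ I y x
    open Ascends ascends public

    grows : ∀ {y x} → 1 ≤ x → x < y → y ≤ n → I y x ≤ I′ y x
    grows {y} {x} 1≤x x<y y≤n with (y ≟ b) ×-dec moved? I a x
    ... | yes (refl , m) = ≤-trans (n≤1+n _) (≤-reflexive (sym (raised 1≤x m)))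
    ... | no ¬m          = ≤-reflexive (sym (kept 1≤x x<y y≤n ¬m))

  -- Tree ascents in terms of inversion numbers

  module _ {T : Tree} (st : IsSTree s T) where

    private
      I = inv s T
      g = sTree⇒good st
      open TreeLike (inv-treeLike st)

    -- The two labels part at `e`; transitivity along `x < y < e` then puts `x` in the later child.
    separated-right : ∀ {y x} → (sep : Separated T y x) → 1 ≤ x → x < y → I y x ≢ 0 →
                      ∃[ e ] ∃[ j ] y < e × e ≤ n × Below T e j y × I e y ≡ j × j < I e x
    separated-right {y} {x} (e , j , k , y<e , β@(_ , _ , _ , ε , _) , β′ , j≢k) 1≤x x<y I≢0 =
      e , j , y<e , e≤n , β , inv-below g β , ≤∧≢⇒< j≤ (λ eq → j≢k (trans eq (inv-below g β′)))
      where
      e≤n = proj₂ (sTree-range st (at⇒∈ ε))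
      j≤ : j ≤ I e x
      j≤ = [ (λ eq → contradiction eq I≢0) , subst (_≤ I e x) (inv-below g β) ]′ (transitive x y e 1≤x x<y y<e e≤n)

    compare-positions : ∀ {y x} → 1 ≤ x → x < y → y ≤ n → (∃[ j ] Below T y j x) ⊎ Separated T y x
    compare-positions {y} {x} 1≤x x<y y≤n
      with ∈⇒at T (sTree-∈ st (≤-trans 1≤x (<⇒≤ x<y)) y≤n) | ∈⇒at T (sTree-∈ st 1≤x (≤-trans (<⇒≤ x<y) y≤n))
    ... | _ , _ , α | _ , _ , β = below-or-separated g x<y α β

    -- An intermediate value cannot come from separated labels: `x` would be further right at the
    -- common ancestor, and planarity would force the value `s(y)`.
    mid⇒inChild : ∀ {y x} → 1 ≤ x → x < y → y ≤ n → 0 < I y x → I y x < sv s y → InChild T y (I y x) x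
    mid⇒inChild {y} {x} 1≤x x<y y≤n 0<i i<s with compare-positions 1≤x x<y y≤n
    ... | inj₁ (j , β) = below⇒inChild g (subst (λ j → Below T y j x) (sym (inv-below g β)) β)
    ... | inj₂ sep with separated-right sep 1≤x x<y (>⇒≢ 0<i)
    ...   | e , j , y<e , e≤n , _ , refl , j<
      = [ (λ eq → contradiction eq (<⇒≢ i<s)) , (λ le → contradiction j< (≤⇒≯ le)) ]′
        (planar x y e 1≤x x<y y<e e≤n)

    treeAscent⇒ascends : ∀ {a b} → TreeAscent s T a b → Ascends I a b
    treeAscent⇒ascends {a} {b} (1≤a , a<b , b≤n , (i , i<s , inCh) , between , lastLeaf) = record
      { 1≤a = 1≤a ; a<b = a<b ; b≤n = b≤n ; gap = gap ; level = level ; right = right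
      ; noMid = λ {e} a<e e<b 0<i i<s → <⇒≢ i<s
          (between e _ a<e e<b (mid⇒inChild 1≤a a<e (≤-trans (<⇒≤ e<b) b≤n) 0<i i<s)) }
      where
      β : Below T b i a
      β = inChild⇒below inCh
      gap : I b a < sv s b
      gap rewrite inv-below g β = i<s
      level : ∀ {r} → b < r → r ≤ n → I r a ≡ I r b
      level b<r r≤n = inv-above g β (sTree-∈ st (≤-trans 1≤a (<⇒≤ (<-trans a<b b<r))) r≤n) b<r
      right : ∀ {p} → 1 ≤ p → p < a → I a p ≡ sv s a → 0 < sv s a → I b a < I b p
      right {p} 1≤p p<a eq 0<s with compare-positions 1≤p p<a (≤-trans (<⇒≤ a<b) b≤n)
      -- Below `a`, the value `s(a)` would put `p` in the last child, which is a leaf.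
      ... | inj₁ (j , β′) with refl ← trans (sym (inv-below g β′)) eq
                             | t , t≡ , p∈t ← below⇒inChild g β′
                             with refl ← just-injective (trans (sym t≡) (lastLeaf 0<s))
                             with () ← p∈t
      right {p} 1≤p p<a eq 0<s | inj₂ sep
        with separated-right sep 1≤p p<a (λ eq′ → >⇒≢ 0<s (trans (sym eq) eq′))
      -- Here `p` is right of `a`, parting at `e`. If `e` is `b`, this is the claim. If `e < b`,
      -- condition (ii) puts `a` in the last child of `e`, leaving no room for `p`. If `b < e`, then
      -- `p` is right of `b` too, and planarity gives `p` the full value at `b`.
      ... | e , j , a<e , e≤n , β′ , refl , j< with <-cmp e b
      ...   | tri≈ _ refl _ = j<
      ...   | tri< e<b _ _ = contradiction (≤-trans j< (bounded 1≤p (<-trans p<a a<e) e≤n))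
                               (<-irrefl (between e _ a<e e<b (below⇒inChild g β′)))
      ...   | tri> _ _ b<e with planar p b e 1≤p (<-trans p<a a<b) b<e e≤n
      ...     | inj₁ full = <-≤-trans gap (≤-reflexive (sym full))
      ...     | inj₂ le   = contradiction (<-≤-trans j< le) (<-irrefl (level b<e e≤n))

  -- The transitive closure defining a rotation

  module _ {I I′ : MIS} {a b : ℕ} (tl : TreeLike s I) (asc : Ascends I a b)
           (tc : IsTC n (plusM s I (single b a)) I′) where

    open TreeLike tl
    open Ascends asc

    private
      Raised : ℕ → ℕ → Set
      Raised y x = y ≡ b × Moved I a x
      raised? : ∀ y x → Dec (Raised y x)
      raised? y x = (y ≟ b) ×-dec moved? I a x
    abstract
      -- The explicit candidate for the closure. Being `abstract`, it is accessible afterwards only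
      -- through `K-yes` and `K-no`.
      K : MIS
      K y x = choose (raised? y x) (suc (I y x)) (I y x)

      K-yes : ∀ {y x} → Raised y x → K y x ≡ suc (I y x)
      K-yes {y} {x} = choose-yes (raised? y x)

      K-no : ∀ {y x} → ¬ Raised y x → K y x ≡ I y x
      K-no {y} {x} = choose-no (raised? y x)

    I≤K : ∀ y x → I y x ≤ K y x
    I≤K y x with raised? y x
    ... | yes r = ≤-trans (n≤1+n _) (≤-reflexive (sym (K-yes r)))
    ... | no ¬r = ≤-reflexive (sym (K-no ¬r))

    -- A positive value at `a` that does not make `p` move must be `s(a)`, and `right` applies.
    unmoved-right : ∀ {p} → 1 ≤ p → p < a → 0 < I a p → ¬ Moved I a p → I b a < I b p
    unmoved-right {p} 1≤p p<a 0<i ¬m = right 1≤p p<a full (subst (0 <_) full 0<i)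
      where
      full : I a p ≡ sv s a
      full = ≤-antisym (bounded 1≤p p<a (≤-trans (<⇒≤ a<b) b≤n)) (≮⇒≥ λ i<s → ¬m (inj₂ (p<a , 0<i , i<s)))

    -- If `I q p` is positive, then so is `I a p`, by transitivity through `a` when `q` differs from
    -- `a`; `unmoved-right` does the rest.
    after-moved : ∀ {p q} → 1 ≤ p → p < q → Moved I a q → ¬ Moved I a p → I q p ≡ 0 ⊎ I b a < I b p
    after-moved {p} {q} 1≤p p<q mq ¬mp with I q p ≟ 0 | mq
    ... | yes eq | _ = inj₁ eq
    ... | no I≢0 | inj₁ refl = inj₂ (unmoved-right 1≤p p<q (n≢0⇒n>0 I≢0) ¬mp)
    ... | no I≢0 | inj₂ (q<a , 0<i , _) = inj₂ (unmoved-right 1≤p (<-trans p<q q<a) 0<iap ¬mp)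
      where
      0<iap : 0 < I a p
      0<iap = [ (λ eq → contradiction eq I≢0) , <-≤-trans 0<i ]′
                (transitive p q a 1≤p p<q q<a (≤-trans (<⇒≤ a<b) b≤n))

    K-transitive : Transitive n K
    K-transitive p q r 1≤p p<q q<r r≤n with r ≟ b
    ... | no r≢b rewrite K-no {r} {q} (r≢b ∘ proj₁) | K-no {r} {p} (r≢b ∘ proj₁)
      with raised? q p
    -- A raised pair in the row of `q = b` is harmless: every larger `r` has the same value at `p`,
    -- `a` and `b`.
    ...   | yes (refl , m) = inj₂ (≤-reflexive (sym (trans (moved-level tl 1≤p m (<-trans a<b q<r) r≤n) (level q<r r≤n))))
    ...   | no ¬m rewrite K-no ¬m = transitive p q r 1≤p p<q q<r r≤n
    K-transitive p q r 1≤p p<q q<r r≤n | yes refl rewrite K-no {q} {p} (<⇒≢ q<r ∘ proj₁)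
      with transitive p q r 1≤p p<q q<r r≤n
    ... | inj₁ eq = inj₁ eq
    ... | inj₂ le with moved? I a q
    ...   | no ¬mq rewrite K-no {r} {q} (¬mq ∘ proj₂) = inj₂ (≤-trans le (I≤K r p))
    ...   | yes mq rewrite K-yes {r} {q} (refl , mq) with moved? I a p
    ...     | yes mp rewrite K-yes {r} {p} (refl , mp) = inj₂ (s≤s le)
    -- Only `q` is raised, so the inequality has to be strict beforehand.
    ...     | no ¬mp rewrite K-no {r} {p} (¬mp ∘ proj₂)
                     | moved-level {r = r} tl (≤-trans 1≤p (<⇒≤ p<q)) mq a<b r≤n = after-moved 1≤p p<q mq ¬mp

    plus⊆K : plusM s I (single b a) ⊆[ n ] K
    plus⊆K x y 1≤x x<y y≤n = ≤-trans (m⊓n≤m _ _) le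
      where
      le : I y x + single b a y x ≤ K y x
      le with raised? y x
      ... | yes r rewrite K-yes r = ≤-trans (+-monoʳ-≤ (I y x) (single-≤1 y x)) (≤-reflexive (+-comm (I y x) 1))
      ... | no ¬r rewrite K-no ¬r = ≤-reflexive (trans
              (cong (I y x +_) (single-elsewhere λ (y≡b , x≡a) → ¬r (y≡b , inj₁ x≡a))) (+-identityʳ _))

    tc-grows : ∀ {y x} → 1 ≤ x → x < y → y ≤ n → I y x ≤ I′ y x
    tc-grows 1≤x x<y y≤n = ≤-trans (⊓-glb (m≤m+n _ _) (bounded 1≤x x<y y≤n)) (proj₁ (proj₂ tc) _ _ 1≤x x<y y≤n)

    -- By `gap`, the truncation at `s(b)` does not swallow the added 1.
    tc-raises : suc (I b a) ≤ I′ b a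
    tc-raises = ≤-trans (⊓-glb (≤-reflexive (trans (sym (+-comm (I b a) 1)) (cong (I b a +_) (sym (single-here {b} {a}))))) gap)
                        (proj₁ (proj₂ tc) a b 1≤a a<b b≤n)

    -- For `x < a`, the value `I′ a x` is still positive, so transitivity of `I′` makes `x` follow
    -- `a` across `b`.
    tc-raises-moved : ∀ {x} → 1 ≤ x → Moved I a x → suc (I b x) ≤ I′ b x
    tc-raises-moved 1≤x (inj₁ refl) = tc-raises
    tc-raises-moved {x} 1≤x m@(inj₂ (x<a , 0<i , _)) with proj₁ tc x a b 1≤x x<a a<b b≤n
    ... | inj₁ eq = contradiction (≤-trans 0<i (tc-grows 1≤x x<a (≤-trans (<⇒≤ a<b) b≤n))) (<-irrefl (sym eq))
    ... | inj₂ le rewrite moved-level tl 1≤x m a<b b≤n = ≤-trans tc-raises le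

    -- Minimality of the closure against the transitive `K` gives the upper bounds; `tc-grows` and
    -- `tc-raises-moved` give the lower ones.
    tc⇒rotates : Rotates I I′ a b
    tc⇒rotates = record
      { ascends = asc
      ; raised  = λ {x} 1≤x m → ≤-antisym
          (≤-trans (I′⊆K x b 1≤x (≤-<-trans (moved-≤ I m) a<b) b≤n) (≤-reflexive (K-yes (refl , m))))
          (tc-raises-moved 1≤x m)
      ; kept    = λ {y} {x} 1≤x x<y y≤n ¬r → ≤-antisym
          (≤-trans (I′⊆K x y 1≤x x<y y≤n) (≤-reflexive (K-no ¬r))) (tc-grows 1≤x x<y y≤n)
      }
      where
      I′⊆K : I′ ⊆[ n ] K
      I′⊆K = proj₂ (proj₂ tc) K K-transitive plus⊆K

  -- Common upper bounds of two rotations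

  module _ {I V W : MIS} {a b c d : ℕ} (tlI : TreeLike s I) (tlV : TreeLike s V) (tlW : TreeLike s W)
           (rv : Rotates I V a b) (rw : Rotates I W c d) (a<c : a < c) where

    private
      module I = TreeLike tlI
      module V = TreeLike tlV
      module W = TreeLike tlW
      module v = Rotates rv
      module w = Rotates rw

    -- The last alternative serves the case `b ≡ c`, in which labels moved with `a` are raised at
    -- `d` as well.
    Changed : MIS → Set
    Changed U = ∀ {y x} → 1 ≤ x → x < y → y ≤ n →
      U y x ≡ I y x ⊎ (y ≡ b × Moved I a x) ⊎ (y ≡ d × Moved I c x) ⊎ (b ≡ c × y ≡ d × Moved I a x)

    max-rotations : MIS
    max-rotations y x = V y x ⊔ W y x

    -- Planarity survives because a full value stays full. Transitivity is in doubt only where one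
    -- rotation raises `(q,p)` from 0; then the other rotation must be shown to keep `q` at most at
    -- the level of `p`.
    max-treeLike : b ≢ c → TreeLike s max-rotations
    max-treeLike b≢c = record { bounded = bounded′ ; transitive = transitive′ ; planar = planar′ }
      where
      M = max-rotations
      bounded′ : ∀ {x y} → 1 ≤ x → x < y → y ≤ n → M y x ≤ sv s y
      bounded′ 1≤x x<y y≤n = ⊔-lub (V.bounded 1≤x x<y y≤n) (W.bounded 1≤x x<y y≤n)
      transitive′ : Transitive n M
      transitive′ p q r 1≤p p<q q<r r≤n
        with q≤n ← ≤-trans (<⇒≤ q<r) r≤n | 1≤q ← ≤-trans 1≤p (<⇒≤ p<q) | p<r ← <-trans p<q q<r
        with V.transitive p q r 1≤p p<q q<r r≤n | W.transitive p q r 1≤p p<q q<r r≤n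
      ... | inj₂ le | inj₂ le′ = inj₂ (⊔-mono-≤ le le′)
      ... | inj₁ eq | inj₁ eq′ rewrite eq | eq′ = inj₁ refl
      ... | inj₁ eq | inj₂ le′ with (q ≟ d) ×-dec moved? I c p
      ...   | no ¬m = inj₁ (n≤0⇒n≡0 (⊔-lub (≤-reflexive eq)
                        (≤-trans (≤-reflexive (w.kept 1≤p p<q q≤n ¬m))
                          (≤-trans (v.grows 1≤p p<q q≤n) (≤-reflexive eq)))))
      ...   | yes (refl , m) = inj₂ (⊔-lub (≤-trans V≤ (m≤m⊔n _ _)) (≤-trans le′ (m≤n⊔m _ _)))
        where
        -- The first rotation does not move `d`, which exceeds `a`, and in `I` the row `r` has equal
        -- values at `d`, `c` and `p`.
        V≤ : V r d ≤ V r p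
        V≤ rewrite v.kept 1≤q q<r r≤n (λ (_ , m′) → <⇒≱ (<-trans a<c w.a<b) (moved-≤ I m′))
                 | sym (w.level q<r r≤n) | sym (moved-level tlI 1≤p m (<-trans w.a<b q<r) r≤n) =
          v.grows 1≤p p<r r≤n
      transitive′ p q r 1≤p p<q q<r r≤n | inj₂ le | inj₁ eq with (q ≟ b) ×-dec moved? I a p
      ...   | no ¬m = inj₁ (n≤0⇒n≡0 (⊔-lub
                        (≤-trans (≤-reflexive (v.kept 1≤p p<q q≤n ¬m))
                          (≤-trans (w.grows 1≤p p<q q≤n) (≤-reflexive eq))) (≤-reflexive eq)))
      ...   | yes (refl , m) = inj₂ (⊔-lub (≤-trans le (m≤m⊔n _ _)) (≤-trans W≤ (m≤n⊔m _ _)))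
        where
        same : ∀ {e} → b < e → e ≤ n → I e p ≡ I e b
        same b<e e≤n = trans (moved-level tlI 1≤p m (<-trans v.a<b b<e) e≤n) (v.level b<e e≤n)
        eqc : b < c → I c b ≡ I c p
        eqc b<c = sym (same b<c (≤-trans (<⇒≤ w.a<b) w.b≤n))
        W≤ : W r b ≤ W r p
        W≤ with (r ≟ d) ×-dec moved? I c b
        ... | no ¬m rewrite w.kept 1≤q q<r r≤n ¬m | sym (same q<r r≤n) = w.grows 1≤p p<r r≤n
        ... | yes (_ , inj₁ b≡c) = contradiction b≡c b≢c
        -- The row of `c` has equal values at `b` and `p`, so `p` moves together with `b` and both
        -- are raised at `d`.
        ... | yes (refl , mb@(inj₂ (b<c , 0<i , i<s)))
          rewrite w.raised 1≤q mb | w.raised 1≤p (inj₂ (<-trans p<q b<c , subst (0 <_) (eqc b<c) 0<i , subst (_< sv s c) (eqc b<c) i<s))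
          = s≤s (≤-reflexive (sym (same q<r r≤n)))
      planar′ : ∀ p q r → 1 ≤ p → p < q → q < r → r ≤ n → M q p ≡ sv s q ⊎ M r p ≤ M r q
      planar′ p q r 1≤p p<q q<r r≤n with V.planar p q r 1≤p p<q q<r r≤n | W.planar p q r 1≤p p<q q<r r≤n
      ... | inj₂ le | inj₂ le′ = inj₂ (⊔-mono-≤ le le′)
      ... | inj₁ eq | _ = inj₁ (≤-antisym (bounded′ 1≤p p<q (≤-trans (<⇒≤ q<r) r≤n)) (≤-trans (≤-reflexive (sym eq)) (m≤m⊔n _ _)))
      ... | inj₂ _ | inj₁ eq = inj₁ (≤-antisym (bounded′ 1≤p p<q (≤-trans (<⇒≤ q<r) r≤n)) (≤-trans (≤-reflexive (sym eq)) (m≤n⊔m _ _)))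

    max-changed : Changed max-rotations
    max-changed {y} {x} 1≤x x<y y≤n with (y ≟ b) ×-dec moved? I a x | (y ≟ d) ×-dec moved? I c x
    ... | yes m | _     = inj₂ (inj₁ m)
    ... | no _  | yes m = inj₂ (inj₂ (inj₁ m))
    ... | no ¬m | no ¬m′ rewrite v.kept 1≤x x<y y≤n ¬m | w.kept 1≤x x<y y≤n ¬m′ = inj₁ (⊔-idem (I y x))

  -- For b = c the maximum need not be transitive: raising (c,a) above 0 forces a to follow c across d.

  module _ {I V W : MIS} {a c d : ℕ} (tlI : TreeLike s I) (tlV : TreeLike s V) (tlW : TreeLike s W)
           (rv : Rotates I V a c) (rw : Rotates I W c d) where

    private
      module I = TreeLike tlI
      module V = TreeLike tlV
      module W = TreeLike tlW
      module v = Rotates rv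
      module w = Rotates rw
      c≤n : c ≤ n
      c≤n = v.b≤n
      c<d : c < d
      c<d = w.a<b

    -- The value `suc (I d c)` is the one that `c` itself has at `d` after the second rotation.
    -- Outside the row of `d` the second rotation changes nothing, so `V` is kept there.
    dragged : MIS
    dragged y x = choose (y ≟ d) (choose (moved? I a x) (suc (I d c)) (W d x)) (V y x)

    private
      U = dragged

      U-off : ∀ {y x} → y ≢ d → U y x ≡ V y x
      U-off {y} = choose-no (y ≟ d)

      U-moved : ∀ {x} → Moved I a x → U d x ≡ suc (I d c)
      U-moved {x} m = trans (choose-yes (d ≟ d) refl) (choose-yes (moved? I a x) m)

      U-unmoved : ∀ {x} → ¬ Moved I a x → U d x ≡ W d x
      U-unmoved {x} m = trans (choose-yes (d ≟ d) refl) (choose-no (moved? I a x) m)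

      same : ∀ {x e} → 1 ≤ x → Moved I a x → c < e → e ≤ n → I e x ≡ I e c
      same 1≤x m c<e e≤n = trans (moved-level tlI 1≤x m (<-trans v.a<b c<e) e≤n) (v.level c<e e≤n)

      V-off : ∀ {y x} → 1 ≤ x → x < y → y ≤ n → c < y → V y x ≡ I y x
      V-off 1≤x x<y y≤n c<y = v.kept 1≤x x<y y≤n (λ (y≡c , _) → >⇒≢ c<y y≡c)

      W-off : ∀ {y x} → 1 ≤ x → x < y → y ≤ n → y ≢ d → W y x ≡ I y x
      W-off 1≤x x<y y≤n y≢d = w.kept 1≤x x<y y≤n (y≢d ∘ proj₁)

      W-cd : W d c ≡ suc (I d c)
      W-cd = w.raised w.1≤a (inj₁ refl)

      -- For `x` moved with `a`, `I d x` equals `I d c`, and the second rotation adds at most 1.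
      W≤U-d : ∀ {x} → 1 ≤ x → x < d → W d x ≤ U d x
      W≤U-d {x} 1≤x x<d = lemma (moved? I a x) (moved? I c x)
        where
        lemma : Dec (Moved I a x) → Dec (Moved I c x) → W d x ≤ U d x
        lemma (no ¬m) _ = ≤-reflexive (sym (U-unmoved ¬m))
        lemma (yes m) (yes m′) = ≤-reflexive (trans (trans (w.raised 1≤x m′) (cong suc (same 1≤x m c<d w.b≤n))) (sym (U-moved m)))
        lemma (yes m) (no ¬m′) = ≤-trans (≤-reflexive (trans (w.kept 1≤x x<d w.b≤n (¬m′ ∘ proj₂)) (same 1≤x m c<d w.b≤n)))
                                         (≤-trans (n≤1+n _) (≤-reflexive (sym (U-moved m))))

    dragged-≥V : V ⊆[ n ] dragged
    dragged-≥V x y 1≤x x<y y≤n with y ≟ d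
    ... | no y≢d = ≤-refl
    ... | yes refl rewrite V-off 1≤x x<y y≤n c<d =
      ≤-trans (w.grows 1≤x x<y y≤n) (subst (W d x ≤_) (choose-yes (d ≟ d) refl) (W≤U-d 1≤x x<y))

    dragged-≥W : W ⊆[ n ] dragged
    dragged-≥W x y 1≤x x<y y≤n with y ≟ d
    ... | no y≢d rewrite W-off 1≤x x<y y≤n y≢d = v.grows 1≤x x<y y≤n
    ... | yes refl = subst (W d x ≤_) (choose-yes (d ≟ d) refl) (W≤U-d 1≤x x<y)

    dragged-changed : Changed tlI tlV tlW rv rw v.a<b dragged
    dragged-changed {y} {x} 1≤x x<y y≤n = lemma (y ≟ d) (moved? I a x) (moved? I c x) (y ≟ c)
      where
      lemma : Dec (y ≡ d) → Dec (Moved I a x) → Dec (Moved I c x) → Dec (y ≡ c) →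
              U y x ≡ I y x ⊎ (y ≡ c × Moved I a x) ⊎ (y ≡ d × Moved I c x) ⊎ (c ≡ c × y ≡ d × Moved I a x)
      lemma (yes refl) (yes m) _        _ = inj₂ (inj₂ (inj₂ (refl , refl , m)))
      lemma (yes refl) (no ¬m) (yes m)  _ = inj₂ (inj₂ (inj₁ (refl , m)))
      lemma (yes refl) (no ¬m) (no ¬m′) _ = inj₁ (trans (U-unmoved ¬m) (w.kept 1≤x x<y y≤n (¬m′ ∘ proj₂)))
      lemma (no y≢d)   (yes m) _ (yes y≡c) = inj₂ (inj₁ (y≡c , m))
      lemma (no y≢d)   (yes m) _ (no y≢c)  = inj₁ (trans (U-off y≢d) (v.kept 1≤x x<y y≤n (y≢c ∘ proj₁)))
      lemma (no y≢d)   (no ¬m) _ _         = inj₁ (trans (U-off y≢d) (v.kept 1≤x x<y y≤n (¬m ∘ proj₂)))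

    dragged-treeLike : TreeLike s dragged
    dragged-treeLike = record { bounded = bounded′ ; transitive = transitive′ ; planar = planar′ }
      where
      bounded′ : ∀ {x y} → 1 ≤ x → x < y → y ≤ n → U y x ≤ sv s y
      bounded′ {x} {y} 1≤x x<y y≤n with y ≟ d
      ... | no _ = V.bounded 1≤x x<y y≤n
      ... | yes refl with moved? I a x
      ...   | yes _ = w.gap
      ...   | no _  = W.bounded 1≤x x<y y≤n

      U-dc : U d c ≡ suc (I d c)
      U-dc = trans (U-unmoved (λ m → <⇒≱ v.a<b (moved-≤ I m))) W-cd

      -- A label with a positive value at `c` follows `c` across `d`: by construction if it moves
      -- with `a`, and otherwise by transitivity of `W`, which has the same value at `(c,p)`.
      above : ∀ {p} → 1 ≤ p → p < c → 0 < V c p → suc (I d c) ≤ U d p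
      above {p} 1≤p p<c 0<V = lemma (moved? I a p)
        where
        lemma : Dec (Moved I a p) → suc (I d c) ≤ U d p
        lemma (yes m) = ≤-reflexive (sym (U-moved m))
        lemma (no ¬m) with W.transitive p c d 1≤p p<c c<d w.b≤n
        ... | inj₂ le = ≤-trans (≤-reflexive (sym W-cd)) (≤-trans le (W≤U-d 1≤p (<-trans p<c c<d)))
        ... | inj₁ eq = contradiction (trans (v.kept 1≤p p<c c≤n (¬m ∘ proj₂))
                                        (trans (sym (W-off 1≤p p<c c≤n (<⇒≢ c<d))) eq)) (>⇒≢ 0<V)

      transitive-d : ∀ p q → 1 ≤ p → p < q → q < d → V q p ≡ 0 ⊎ U d q ≤ U d p
      transitive-d p q 1≤p p<q q<d = lemma (q ≟ c) (moved? I a q)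
        where
        1≤q = ≤-trans 1≤p (<⇒≤ p<q)
        q≤n = ≤-trans (<⇒≤ q<d) w.b≤n
        lemma : Dec (q ≡ c) → Dec (Moved I a q) → V q p ≡ 0 ⊎ U d q ≤ U d p
        lemma (yes refl) _ with V q p ≟ 0
        ... | yes eq = inj₁ eq
        ... | no V≢0 = inj₂ (≤-trans (≤-reflexive U-dc) (above 1≤p p<q (n≢0⇒n>0 V≢0)))
        -- The first rotation has made `V c q` positive; transitivity of `V` makes `V c p` positive
        -- too, and `above` applies.
        lemma (no q≢c) (yes m) with V.transitive p q c 1≤p p<q (≤-<-trans (moved-≤ I m) v.a<b) c≤n
        ... | inj₁ eq = inj₁ eq
        ... | inj₂ le rewrite v.raised 1≤q m =
          inj₂ (≤-trans (≤-reflexive (U-moved m)) (above 1≤p (<-≤-trans p<q (<⇒≤ (≤-<-trans (moved-≤ I m) v.a<b))) (≤-trans (s≤s z≤n) le)))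
        lemma (no q≢c) (no ¬m) with W.transitive p q d 1≤p p<q q<d w.b≤n
        ... | inj₁ eq = inj₁ (trans (v.kept 1≤p p<q q≤n (q≢c ∘ proj₁)) (trans (sym (W-off 1≤p p<q q≤n (<⇒≢ q<d))) eq))
        ... | inj₂ le = inj₂ (≤-trans (≤-reflexive (U-unmoved ¬m)) (≤-trans le (W≤U-d 1≤p (<-trans p<q q<d))))

      transitive-off : ∀ p q r → 1 ≤ p → p < q → q < r → r ≤ n → U q p ≡ 0 ⊎ V r q ≤ V r p
      transitive-off p q r 1≤p p<q q<r r≤n with V.transitive p q r 1≤p p<q q<r r≤n
      ... | inj₂ le = inj₂ le
      ... | inj₁ eq with q ≟ d
      ...   | no _ = inj₁ eq
      ...   | yes refl = lemma
        where
        p<r = <-trans p<q q<r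
        c<r = <-trans c<d q<r
        -- For `q = d`, only a `p` moved with `a` or `c` can have been raised from 0. Row `r` then
        -- has equal values at `p`, `c` and `d`.
        back : I r p ≡ I r c → V r d ≤ V r p
        back eq′ rewrite V-off 1≤p p<r r≤n c<r | V-off w.1≤b q<r r≤n c<r | eq′ = ≤-reflexive (sym (w.level q<r r≤n))
        lemma : choose (moved? I a p) (suc (I d c)) (W d p) ≡ 0 ⊎ V r d ≤ V r p
        lemma with moved? I a p
        ... | yes m = inj₂ (back (same 1≤p m c<r r≤n))
        ... | no _ with moved? I c p
        ...   | yes m = inj₂ (back (moved-level tlI 1≤p m c<r r≤n))
        ...   | no ¬m = inj₁ (trans (w.kept 1≤p p<q w.b≤n (¬m ∘ proj₂)) (trans (sym (V-off 1≤p p<q w.b≤n c<d)) eq))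

      transitive′ : Transitive n U
      transitive′ p q r 1≤p p<q q<r r≤n = lemma (r ≟ d)
        where
        lemma : Dec (r ≡ d) → U q p ≡ 0 ⊎ U r q ≤ U r p
        lemma (no r≢d) rewrite U-off {r} {q} r≢d | U-off {r} {p} r≢d = transitive-off p q r 1≤p p<q q<r r≤n
        lemma (yes refl) rewrite U-off {q} {p} (<⇒≢ q<r) = transitive-d p q 1≤p p<q q<r

      planar′ : ∀ p q r → 1 ≤ p → p < q → q < r → r ≤ n → U q p ≡ sv s q ⊎ U r p ≤ U r q
      planar′ p q r 1≤p p<q q<r r≤n = lemma (r ≟ d) (moved? I a p)
        where
        q≤n = ≤-trans (<⇒≤ q<r) r≤n
        1≤q = ≤-trans 1≤p (<⇒≤ p<q)
        full : ∀ {i} → i ≡ sv s q → i ≤ U q p → U q p ≡ sv s q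
        full refl le = ≤-antisym (bounded′ 1≤p p<q q≤n) le
        lemma : Dec (r ≡ d) → Dec (Moved I a p) → U q p ≡ sv s q ⊎ U r p ≤ U r q
        lemma (no r≢d) _ with V.planar p q r 1≤p p<q q<r r≤n
        ... | inj₁ eq = inj₁ (full eq (dragged-≥V p q 1≤p p<q q≤n))
        ... | inj₂ le rewrite U-off {r} {q} r≢d | U-off {r} {p} r≢d = inj₂ le
        lemma (yes refl) (no ¬m) with W.planar p q r 1≤p p<q q<r r≤n
        ... | inj₁ eq = inj₁ (full eq (dragged-≥W p q 1≤p p<q q≤n))
        ... | inj₂ le = inj₂ (≤-trans (≤-reflexive (U-unmoved ¬m)) (≤-trans le (W≤U-d 1≤q q<r)))
        lemma (yes refl) (yes m) rewrite U-moved m with <-cmp q c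
        ... | tri≈ _ refl _ = inj₂ (≤-reflexive (sym U-dc))
        -- Row `q` has equal values at `p` and `c`, so planarity of `W` is applied to `c` in place
        -- of `p`.
        ... | tri> _ _ c<q with W.planar c q d w.1≤a c<q q<r r≤n
        ...   | inj₁ eq = inj₁ (full eq (≤-trans (≤-reflexive
                            (trans (W-off w.1≤a c<q q≤n (<⇒≢ q<r)) (trans (sym (same 1≤p m c<q q≤n))
                              (sym (W-off 1≤p p<q q≤n (<⇒≢ q<r)))))) (dragged-≥W p q 1≤p p<q q≤n)))
        ...   | inj₂ le = inj₂ (≤-trans (≤-reflexive (sym W-cd)) (≤-trans le (W≤U-d 1≤q q<r)))
        -- Planarity of `V` below `c` compares `V c q` with the raised, hence positive, `V c p`.
        lemma (yes refl) (yes m) | tri< q<c _ _ with V.planar p q c 1≤p p<q q<c c≤n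
        ...   | inj₁ eq = inj₁ (full eq (dragged-≥V p q 1≤p p<q q≤n))
        ...   | inj₂ le rewrite v.raised 1≤p m = inj₂ (above 1≤q q<c (≤-trans (s≤s z≤n) le))

-- Edges below the common bound

module _ (s : List ℕ) where

  private n = length s

  module _ {I V W : MIS} {a b c d : ℕ} (tlI : TreeLike s I) (tlV : TreeLike s V) (tlW : TreeLike s W)
           (rv : Rotates s I V a b) (rw : Rotates s I W c d) (a<c : a < c) where

    common-bound : ∃[ U ] TreeLike s U × V ⊆[ n ] U × W ⊆[ n ] U × Changed s tlI tlV tlW rv rw a<c U
    common-bound with b ≟ c
    ... | no b≢c = max-rotations s tlI tlV tlW rv rw a<c , max-treeLike s tlI tlV tlW rv rw a<c b≢c
                 , (λ _ _ _ _ _ → m≤m⊔n _ _) , (λ _ _ _ _ _ → m≤n⊔m _ _) , max-changed s tlI tlV tlW rv rw a<c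
    ... | yes refl = dragged s tlI tlV tlW rv rw , dragged-treeLike s tlI tlV tlW rv rw
                   , dragged-≥V s tlI tlV tlW rv rw , dragged-≥W s tlI tlV tlW rv rw
                   , (λ {y} {x} → dragged-changed s tlI tlV tlW rv rw {y} {x})

    module _ {U K K′ : MIS} {a′ b′ : ℕ} (changed : Changed s tlI tlV tlW rv rw a<c U)
             (I⊆K : I ⊆[ n ] K) (K⊆U : K ⊆[ n ] U) (K′⊆U : K′ ⊆[ n ] U) (rk : Rotates s K K′ a′ b′) where

      private
        module v = Rotates rv
        module w = Rotates rw
        module k = Rotates rk

        -- `K` lies between `I` and `U`, so where these agree it has their value, and `k.noMid`
        -- excludes an intermediate one.
        frozen-mid : ∀ {e} → a′ < e → e < b′ → 0 < I e a′ → I e a′ < sv s e → U e a′ ≢ I e a′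
        frozen-mid {e} a′<e e<b′ 0<i i<s eq = k.noMid a′<e e<b′ (subst (0 <_) (sym K≡) 0<i) (subst (_< sv s e) (sym K≡) i<s)
          where
          e≤n = ≤-trans (<⇒≤ e<b′) k.b≤n
          K≡ : K e a′ ≡ I e a′
          K≡ = ≤-antisym (≤-trans (K⊆U a′ e k.1≤a a′<e e≤n) (≤-reflexive eq)) (I⊆K a′ e k.1≤a a′<e e≤n)

        -- The row of `a` is the same in `I` and `U`, as `a` is neither `b` nor `d`; so `frozen-mid`
        -- leaves only `a` itself.
        moved-a : a < b′ → Moved s I a a′ → a′ ≡ a
        moved-a a<b′ (inj₁ eq) = eq
        moved-a a<b′ (inj₂ (a′<a , 0<i , i<s))
          with changed k.1≤a a′<a (≤-trans (<⇒≤ v.a<b) v.b≤n)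
        ... | inj₁ eq                       = contradiction eq (frozen-mid a′<a a<b′ 0<i i<s)
        ... | inj₂ (inj₁ (a≡b , _))         = contradiction a≡b (<⇒≢ v.a<b)
        ... | inj₂ (inj₂ (inj₁ (a≡d , _)))  = contradiction a≡d (<⇒≢ (<-trans a<c w.a<b))
        ... | inj₂ (inj₂ (inj₂ (_ , a≡d , _))) = contradiction a≡d (<⇒≢ (<-trans a<c w.a<b))

        -- The row of `c` can differ only when `c` is `b`, and then only at labels moved with `a`,
        -- which `moved-a` handles.
        moved-c : c < b′ → Moved s I c a′ → a′ ≡ a ⊎ a′ ≡ c
        moved-c c<b′ (inj₁ eq) = inj₂ eq
        moved-c c<b′ (inj₂ (a′<c , 0<i , i<s))
          with changed k.1≤a a′<c (≤-trans (<⇒≤ w.a<b) w.b≤n)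
        ... | inj₁ eq                       = contradiction eq (frozen-mid a′<c c<b′ 0<i i<s)
        ... | inj₂ (inj₁ (_ , m))           = inj₁ (moved-a (<-trans a<c c<b′) m)
        ... | inj₂ (inj₂ (inj₁ (c≡d , _)))  = contradiction c≡d (<⇒≢ w.a<b)
        ... | inj₂ (inj₂ (inj₂ (_ , c≡d , _))) = contradiction c≡d (<⇒≢ w.a<b)

      -- The edge raises `(b′,a′)` while staying below `U`, so `U` exceeds `I` there and `changed`
      -- makes `a′` a label moved with `a` or with `c`.
      label-restricted : a′ ≡ a ⊎ a′ ≡ c
      label-restricted with changed k.1≤a k.a<b k.b≤n
      ... | inj₁ eq = contradiction (≤-trans (≤-reflexive (sym (k.raised k.1≤a (inj₁ refl)))) (K′⊆U _ _ k.1≤a k.a<b k.b≤n))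
                        (≤⇒≯ (≤-trans (≤-reflexive eq) (I⊆K _ _ k.1≤a k.a<b k.b≤n)))
      ... | inj₂ (inj₁ (refl , m))               = inj₁ (moved-a v.a<b m)
      ... | inj₂ (inj₂ (inj₁ (refl , m)))        = moved-c w.a<b m
      ... | inj₂ (inj₂ (inj₂ (_ , refl , m)))    = inj₁ (moved-a (<-trans a<c w.a<b) m)

  isTC-unique : ∀ {M K K′} → IsTC n M K → IsTC n M K′ → K ⊆[ n ] K′
  isTC-unique (_ , _ , least) (tr , incl , _) = least _ tr incl

  ≼-antisym : ∀ {T Z} → IsSTree s T → IsSTree s Z → T ≼[ s ] Z → Z ≼[ s ] T → T ≡ Z
  ≼-antisym st st′ le ge = sTree-injective st st′ λ 1≤x x<y y≤n → ≤-antisym (le _ _ 1≤x x<y y≤n) (ge _ _ 1≤x x<y y≤n)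

  ⊆-trans : ∀ {I J K} → I ⊆[ n ] J → J ⊆[ n ] K → I ⊆[ n ] K
  ⊆-trans le le′ x y 1≤x x<y y≤n = ≤-trans (le x y 1≤x x<y y≤n) (le′ x y 1≤x x<y y≤n)

  -- If `b < b′`, condition (ii) for `b′` puts `a` in the last child of `b`, against condition (i)
  -- for `b`.
  ascent-≮ : ∀ T {a b b′} → TreeAscent s T a b → TreeAscent s T a b′ → ¬ b < b′
  ascent-≮ T (_ , a<b , _ , (i , i<s , inCh) , _) (_ , _ , _ , _ , between , _) b<b′ =
    <⇒≢ i<s (between _ i a<b b<b′ inCh)

  ascent-unique : ∀ T {a b b′} → TreeAscent s T a b → TreeAscent s T a b′ → b ≡ b′
  ascent-unique T asc asc′ = ≤-antisym (≮⇒≥ (ascent-≮ T asc′ asc)) (≮⇒≥ (ascent-≮ T asc asc′))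

  chain-≼ : ∀ {T J} → SatChain s T J → T ≼[ s ] J
  chain-≼ done                                  = λ _ _ _ _ _ → ≤-refl
  chain-≼ (step (_ , _ , (T≼Z , _) , _) chain)  = ⊆-trans T≼Z (chain-≼ chain)

  -- The conditions of an SB-labeling

  module _ (lab : Labeling s) (rotation-label : ∀ T Z (c : Cover s T Z) → RotLabel s T Z (lab T Z c)) where

    cover-rotates : ∀ {T Z} (c : Cover s T Z) → ∃[ b ] Rotates s (inv s T) (inv s Z) (lab T Z c) b
    cover-rotates {T} {Z} c with b , asc , _ , tc ← rotation-label T Z c =
      b , tc⇒rotates s (inv-treeLike (proj₁ c)) (treeAscent⇒ascends s (proj₁ c) asc) tc

    -- Equal labels give equal ascents, and two closures of the same set contain each other.
    labels-distinct : ∀ {u v w} (cv : Cover s u v) (cw : Cover s u w) → v ≢ w → lab u v cv ≢ lab u w cw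
    labels-distinct {u} {v} {w} cv cw v≢w eq
      with b , asc , stv , tcv ← rotation-label u v cv | b′ , asc′ , stw , tcw ← rotation-label u w cw
      rewrite eq with refl ← ascent-unique u asc asc′ =
      v≢w (≼-antisym stv stw (isTC-unique tcv tcw) (isTC-unique tcw tcv))

    only-uses : ∀ {u v w J} (cv : Cover s u v) (cw : Cover s u w) → lab u v cv < lab u w cw →
                IsJoin s v w J → (ch : SatChain s u J) → OnlyUses lab ch (lab u v cv) (lab u w cw)
    only-uses {u} {v} {w} {J} cv cw a<c (_ , _ , _ , least) ch
      with tlu ← inv-treeLike (proj₁ cv) | tlv ← inv-treeLike (proj₁ (proj₂ cv)) | tlw ← inv-treeLike (proj₁ (proj₂ cw))
      with _ , rv ← cover-rotates cv | _ , rw ← cover-rotates cw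
      with U , tlU , V⊆U , W⊆U , changed ← common-bound tlu tlv tlw rv rw a<c
      -- The join is least among trees only, so the bound `U` has to be realised by a tree `R`.
      with R , stR , R≡U ← treeLike⇒sTree tlU = go ch (λ _ _ _ _ _ → ≤-refl)
      where
      J≼R : J ≼[ s ] R
      J≼R = least R stR
        (λ x y 1≤x x<y y≤n → ≤-trans (V⊆U x y 1≤x x<y y≤n) (≤-reflexive (sym (R≡U 1≤x x<y y≤n))))
        (λ x y 1≤x x<y y≤n → ≤-trans (W⊆U x y 1≤x x<y y≤n) (≤-reflexive (sym (R≡U 1≤x x<y y≤n))))
      ⊆U : ∀ {T} → SatChain s T J → inv s T ⊆[ n ] U
      ⊆U chain x y 1≤x x<y y≤n = ≤-trans (⊆-trans (chain-≼ chain) J≼R x y 1≤x x<y y≤n) (≤-reflexive (R≡U 1≤x x<y y≤n))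
      go : ∀ {T} (chain : SatChain s T J) → u ≼[ s ] T → OnlyUses lab chain (lab u v cv) (lab u w cw)
      go done u≼T = tt
      go (step c@(_ , _ , (T≼Z , _) , _) rest) u≼T with _ , rk ← cover-rotates c =
        label-restricted tlu tlv tlw rv rw a<c (λ {y} {x} → changed {y} {x}) u≼T (⊆U (step c rest)) (⊆U rest) rk
        , go rest (⊆-trans u≼T T≼Z)

    -- Rotations labeled c can raise the pair (b,a) only if 0 < #(c,a) < s(c), and they leave #(c,a) itself unchanged.
    uses-raised : ∀ {T J a b c} → 1 ≤ a → a < b → b ≤ n → a ≢ c →
                  (a < c → c < b → 0 < inv s T c a → inv s T c a < sv s c → ⊥) →
                  (ch : SatChain s T J) → OnlyUses lab ch a c → inv s T b a < inv s J b a → Uses lab ch a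
    uses-raised 1≤a a<b b≤n a≢c noMid done only lt = contradiction lt (<-irrefl refl)
    uses-raised 1≤a a<b b≤n a≢c noMid (step cov rest) (inj₁ eq , only) lt = inj₁ eq
    uses-raised {T} {J} {a} {b} 1≤a a<b b≤n a≢c noMid (step {t′ = Z} cov rest) (inj₂ refl , only) lt =
      inj₂ (uses-raised 1≤a a<b b≤n a≢c noMid′ rest only (subst (_< inv s J b a) (sym same-ba) lt))
      where
      c = lab T Z cov
      module r = Rotates (proj₂ (cover-rotates cov))
      same-ba : inv s Z b a ≡ inv s T b a
      same-ba = r.kept 1≤a a<b b≤n λ where
        (b≡e , inj₁ a≡c) → a≢c a≡c
        (b≡e , inj₂ (a<c , 0<i , i<s)) → noMid a<c (subst (c <_) (sym b≡e) r.a<b) 0<i i<s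
      noMid′ : a < c → c < b → 0 < inv s Z c a → inv s Z c a < sv s c → ⊥
      noMid′ a<c c<b with eq ← r.kept 1≤a a<c (≤-trans (<⇒≤ r.a<b) r.b≤n) (λ (c≡e , _) → <⇒≢ r.a<b c≡e)
        rewrite eq = noMid a<c c<b

    -- The pair raised by the cover is higher in `J` than in `u`, so the chain has to raise it
    -- somewhere.
    uses-label : ∀ {u v J c} (cv : Cover s u v) → lab u v cv ≢ c → v ≼[ s ] J →
                 (ch : SatChain s u J) → OnlyUses lab ch (lab u v cv) c → Uses lab ch (lab u v cv)
    uses-label cv a≢c v≼J ch only with b , rv ← cover-rotates cv =
      uses-raised v.1≤a v.a<b v.b≤n a≢c v.noMid ch only
        (≤-trans (≤-reflexive (sym (v.raised v.1≤a (inj₁ refl)))) (v≼J _ _ v.1≤a v.a<b v.b≤n))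
      where module v = Rotates rv

  onlyUses-swap : ∀ {lab : Labeling s} {T J a c} (ch : SatChain s T J) → OnlyUses lab ch a c → OnlyUses lab ch c a
  onlyUses-swap done          _             = tt
  onlyUses-swap (step _ rest) (eqs , only)  = swap eqs , onlyUses-swap rest only

theorem3p20 : (s : List ℕ) (lab : Labeling s) →
    (∀ T Z (c : Cover s T Z) → RotLabel s T Z (lab T Z c)) →
    IsSBLabeling s lab
theorem3p20 s lab rotation-label u v w cv cw v≢w = distinct , chains
  where
  distinct = labels-distinct s lab rotation-label cv cw v≢w

  chains : ∀ J → IsJoin s v w J → (ch : SatChain s u J) →
           Uses lab ch (lab u v cv) × Uses lab ch (lab u w cw) × OnlyUses lab ch (lab u v cv) (lab u w cw)
  chains J join@(stJ , v≼J , w≼J , least) ch =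
    uses-label s lab rotation-label cv distinct v≼J ch only ,
    uses-label s lab rotation-label cw (distinct ∘ sym) w≼J ch (onlyUses-swap s ch only) ,
    only
    where
    only : OnlyUses lab ch (lab u v cv) (lab u w cw)
    only with <-cmp (lab u v cv) (lab u w cw)
    ... | tri< a<c _ _ = only-uses s lab rotation-label cv cw a<c join ch
    ... | tri≈ _ eq _  = contradiction eq distinct
    ... | tri> _ _ c<a = onlyUses-swap s ch
      (only-uses s lab rotation-label cw cv c<a (stJ , w≼J , v≼J , λ R stR w≼R v≼R → least R stR v≼R w≼R) ch)
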